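{- The robot reachability problem for 0-player directed-edge motion planning with spawners, restricted to systems built from copies of the spawner, the increment gadget, the register gadget, and the UPDSDS gadget, is RE-hard (with respect to computable many-one reductions). Here the problem is: given such a system and a target location, decide whether any robot ever reaches the target location in finite time.
   Context: A gadget consists of a finite set of locations and a finite set of states, together with a transition graph: a directed graph on (state, location) pairs, where an edge from $(S,a)$ to $(S',b)$ means that a robot can enter the gadget at $a$ when the gadget is in state $S$, exit at $b$, and thereby change the gadget's state to $S'$. Traversing a gadget does not change the state of any other gadget. A gadget is deterministic if its transition graph has maximum out-degree 1. A spawner is a special 1-location gadget that creates new robots at its location. 0-player directed-edge motion planning with spawners: a system consists of finitely many deterministic gadgets with initial states, spawners, and a directed connection graph on the gadget locations, such that each gadget location either has only incoming edges (robots enter the gadget there) or has only outgoing edges and at most one of them (robots exit the gadget there). There is no player; all motion is forced. Time is divided into rounds. In each round, each existing robot takes a turn, in the order in which the robots were spawned, and then each spawner spawns one new robot at its location, in a predefined order of the spawners. A robot's turn consists of moving along the directed edge it is on until it either traverses one gadget (if the gadget whose entrance it reaches has a transition from that location in its current state) or gets stuck (it is at a point where all edges are directed towards its position and it cannot traverse); a stuck robot stays where it is and may traverse on a later turn if the gadget's state then permits. Increment gadget: 4 states $0,1,2,3$ and 10 locations: path-selector entrances $p_1,p_2,p_3$ and exits $q_1,q_2,q_3$, a lock-branch entrance $e$ and lock-branch exits $f_1,f_2,f_3$. In the original state $0$ the transitions are $p_i\to q_i$, changing the state to $i$ ($i=1,2,3$). In state $i\in\{1,2,3\}$ the only transition is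 $e\to f_i$, changing the state to $0$. Register gadget: 3 states $0,D,J$ and 10 locations: path-selector paths $p_D\to q_D$ (top) and $p_J\to q_J$ (bottom); a processing branch with entrance $e$ and exits $f_D,f_J$; a response branch with entrance $r$ and exits $s_{\mathrm{top}},s_{\mathrm{bot}}$. In the original state $0$: $p_D\to q_D$ changes the state to $D$; $p_J\to q_J$ changes the state to $J$; $r\to s_{\mathrm{top}}$ leaves the state $0$; the processing branch is closed. In state $D$: the path selector is closed; $e\to f_D$ changes the state to $0$; $r\to s_{\mathrm{top}}$ changes the state to $0$. In state $J$: the path selector is closed; $e\to f_J$ changes the state to $0$; $r\to s_{\mathrm{bot}}$ changes the state to $0$. There are no other transitions. UPDSDS gadget: two states "up" and "down" and 8 locations: a directed tunnel $t_{\mathrm{in}}\to t_{\mathrm{out}}$, traversable in both states, that sets the state to "up"; and two switches $j=1,2$, each with one input $x_j$ and two outputs $y_j^{\mathrm{up}},y_j^{\mathrm{down}}$: a robot entering at $x_j$ exits at $y_j^{\mathrm{up}}$ if the state is "up" and at $y_j^{\mathrm{down}}$ if the state is "down", and the traversal sets the state to "down". -}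

module Defs where

open import Data.Fin.Base using (Fin; toℕ)
open import Data.Fin.Patterns
open import Data.Fin.Properties using (toℕ-injective) renaming (_≟_ to _≟ᶠ_)
open import Data.List.Base as List
  using (List; []; _∷_; _++_; head; filter; length; allFin)
open import Data.List.Membership.Propositional using (_∈_; _∉_)
open import Data.List.Relation.Unary.All using (All)
open import Data.List.Relation.Unary.Unique.Propositional using (Unique)
open import Data.Maybe.Base using (Maybe; just; nothing; fromMaybe)
open import Data.Nat.Base
  using (ℕ; zero; suc; _+_; _<_; _≤_; s≤s; _≤′_; ≤′-step; ≤′-reflexive)
open import Data.Nat.Properties
  using ( suc-injective; <-cmp; +-comm; +-cancelˡ-≡; +-cancelʳ-≡; +-monoʳ-≤
        ; ≤-trans; ≤-reflexive; ≤⇒≤′; m≤n+m; m≤m+n; <⇒≢; <-≤-trans)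
open import Data.Product.Base using (Σ; Σ-syntax; ∃-syntax; _×_; _,_; proj₁; proj₂)
import Data.Product.Properties as Product
open import Data.Sum.Base using (_⊎_; inj₁; inj₂)
import Data.Sum.Properties as Sum
open import Data.Vec.Base using (Vec; []; _∷_; lookup)
open import Data.Vec.Relation.Binary.Pointwise.Inductive using (Pointwise)
open import Function.Base using (_∘_)
open import Function.Bundles using (_⇔_; _↣_; mk↣; module Injection)
open import Relation.Binary.Definitions using (DecidableEquality; tri<; tri≈; tri>)
open import Relation.Binary.PropositionalEquality
  using (_≡_; refl; sym; trans; cong; cong₂)
open import Relation.Nullary using (yes; no; contradiction)

------------------------------------------------------------------------
-- Computability: Kleene's partial recursive functions

data PR : ℕ → Set where
  zero′ : PR 0
  suc′  : PR 1
  proj  : ∀ {n} → Fin n → PR n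
  comp  : ∀ {m n} → PR m → Vec (PR n) m → PR n
  rec   : ∀ {n} → PR n → PR (suc (suc n)) → PR (suc n)
  μ     : ∀ {n} → PR (suc n) → PR n

infix 4 _[_]⇓_

-- f [ xs ]⇓ y : the partial function denoted by f is defined at xs, with value y.
data _[_]⇓_ : ∀ {n} → PR n → Vec ℕ n → ℕ → Set where
  zero⇓ : zero′ [ [] ]⇓ 0
  suc⇓  : ∀ {x} → suc′ [ x ∷ [] ]⇓ suc x
  proj⇓ : ∀ {n} {i : Fin n} {xs} → proj i [ xs ]⇓ lookup xs i
  comp⇓ : ∀ {m n} {f : PR m} {gs : Vec (PR n) m} {xs ys y} →
          Pointwise (λ g z → g [ xs ]⇓ z) gs ys → f [ ys ]⇓ y →
          comp f gs [ xs ]⇓ y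
  rec⇓0 : ∀ {n} {f : PR n} {g xs y} →
          f [ xs ]⇓ y → rec f g [ 0 ∷ xs ]⇓ y
  rec⇓s : ∀ {n} {f : PR n} {g xs k z y} →
          rec f g [ k ∷ xs ]⇓ z → g [ k ∷ z ∷ xs ]⇓ y →
          rec f g [ suc k ∷ xs ]⇓ y
  μ⇓    : ∀ {n} {f : PR (suc n)} {xs y} →
          f [ y ∷ xs ]⇓ 0 →
          (∀ {i} → i < y → ∃[ k ] f [ i ∷ xs ]⇓ suc k) →
          μ f [ xs ]⇓ y

Computable : (ℕ → ℕ) → Set
Computable f = ∃[ c ] ∀ n → c [ n ∷ [] ]⇓ f n

RE : (ℕ → Set) → Set
RE L = Σ[ c ∈ PR 1 ] ∀ n → L n ⇔ (∃[ y ] c [ n ∷ [] ]⇓ y)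

-- Many-one hardness of a decision problem P whose instances, of type A, are
-- presented to algorithms through a numbering of A.
REHard : {A : Set} → A ↣ ℕ → (A → Set) → Set₁
REHard {A} code P =
  (L : ℕ → Set) → RE L →
  Σ[ f ∈ (ℕ → A) ] Computable (Injection.to code ∘ f) × (∀ n → L n ⇔ P (f n))

------------------------------------------------------------------------
-- Numberings of finite data

triangle : ℕ → ℕ
triangle zero    = 0
triangle (suc n) = suc n + triangle n

-- Cantor's pairing function
pair : ℕ → ℕ → ℕ
pair a b = triangle (a + b) + b

private
  triangle-mono′ : ∀ {m n} → m ≤′ n → triangle m ≤ triangle n
  triangle-mono′ (≤′-reflexive refl)   = ≤-reflexive refl
  triangle-mono′ (≤′-step {n = n} m≤n) =
    ≤-trans (triangle-mono′ m≤n) (m≤n+m (triangle n) (suc n))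

  pair-< : ∀ a b c d → a + b < c + d → pair a b < pair c d
  pair-< a b c d lt = <-≤-trans
    (s≤s (≤-trans (+-monoʳ-≤ (triangle (a + b)) (m≤n+m b a))
                  (≤-reflexive (+-comm (triangle (a + b)) (a + b)))))
    (≤-trans (triangle-mono′ (≤⇒≤′ lt)) (m≤m+n (triangle (c + d)) d))

pair-injective : ∀ a b c d → pair a b ≡ pair c d → a ≡ c × b ≡ d
pair-injective a b c d eq with <-cmp (a + b) (c + d)
... | tri< lt _ _ = contradiction eq (<⇒≢ (pair-< a b c d lt))
... | tri> _ _ gt = contradiction (sym eq) (<⇒≢ (pair-< c d a b gt))
... | tri≈ _ s _  = +-cancelʳ-≡ b a c (trans s (cong (c +_) (sym b≡d))) , b≡d
  where
  b≡d : b ≡ d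
  b≡d = +-cancelˡ-≡ (triangle (a + b)) b d
          (trans eq (cong (λ k → triangle k + d) (sym s)))

code-ℕ : ℕ ↣ ℕ
code-ℕ = mk↣ {to = λ n → n} (λ eq → eq)

code-Fin : ∀ n → Fin n ↣ ℕ
code-Fin n = mk↣ {to = toℕ} toℕ-injective

code-Σ : {A : Set} {B : A → Set} → A ↣ ℕ → (∀ a → B a ↣ ℕ) → Σ A B ↣ ℕ
code-Σ {A} {B} cA cB = mk↣ {to = to} inj
  where
  to : Σ A B → ℕ
  to (a , b) = pair (Injection.to cA a) (Injection.to (cB a) b)
  inj : ∀ {p q} → to p ≡ to q → p ≡ q
  inj {a , b} {a′ , b′} eq with pair-injective (Injection.to cA a) _ _ _ eq
  ... | eqa , eqb with Injection.injective cA eqa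
  ... | refl = cong (a ,_) (Injection.injective (cB a) eqb)

code-⊎ : {A B : Set} → A ↣ ℕ → B ↣ ℕ → (A ⊎ B) ↣ ℕ
code-⊎ {A} {B} cA cB = mk↣ {to = to} inj
  where
  to : A ⊎ B → ℕ
  to (inj₁ a) = pair 0 (Injection.to cA a)
  to (inj₂ b) = pair 1 (Injection.to cB b)
  inj : ∀ {p q} → to p ≡ to q → p ≡ q
  inj {inj₁ a} {inj₁ a′} eq =
    cong inj₁ (Injection.injective cA
      (proj₂ (pair-injective 0 (Injection.to cA a) 0 (Injection.to cA a′) eq)))
  inj {inj₂ b} {inj₂ b′} eq =
    cong inj₂ (Injection.injective cB
      (proj₂ (pair-injective 1 (Injection.to cB b) 1 (Injection.to cB b′) eq)))
  inj {inj₁ a} {inj₂ b} eq with pair-injective 0 (Injection.to cA a) 1 (Injection.to cB b) eq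
  ... | () , _
  inj {inj₂ b} {inj₁ a} eq with pair-injective 1 (Injection.to cB b) 0 (Injection.to cA a) eq
  ... | () , _

code-List : {A : Set} → A ↣ ℕ → List A ↣ ℕ
code-List {A} cA = mk↣ {to = to} inj
  where
  to : List A → ℕ
  to []       = 0
  to (x ∷ xs) = suc (pair (Injection.to cA x) (to xs))
  inj : ∀ {xs ys} → to xs ≡ to ys → xs ≡ ys
  inj {[]}     {[]}     eq = refl
  inj {x ∷ xs} {y ∷ ys} eq
    with pair-injective (Injection.to cA x) _ _ _ (suc-injective eq)
  ... | eqx , eqxs = cong₂ _∷_ (Injection.injective cA eqx) (inj eqxs)

------------------------------------------------------------------------
-- Gadgets

-- Determinism is built in: out-degree at most 1 makes the transition graph a
-- partial function on (state, location) pairs.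
record Gadget : Set where
  field
    #states    : ℕ
    #locations : ℕ
    transition : Fin #states → Fin #locations → Maybe (Fin #states × Fin #locations)

open Gadget public

module Increment where
  pattern p₁ = 0F
  pattern p₂ = 1F
  pattern p₃ = 2F
  pattern q₁ = 3F
  pattern q₂ = 4F
  pattern q₃ = 5F
  pattern e  = 6F
  pattern f₁ = 7F
  pattern f₂ = 8F
  pattern f₃ = 9F

  step : Fin 4 → Fin 10 → Maybe (Fin 4 × Fin 10)
  step 0F p₁ = just (1F , q₁)
  step 0F p₂ = just (2F , q₂)
  step 0F p₃ = just (3F , q₃)
  step 1F e  = just (0F , f₁)
  step 2F e  = just (0F , f₂)
  step 3F e  = just (0F , f₃)
  step _  _  = nothing

module Register where
  pattern O = 0F
  pattern D = 1F
  pattern J = 2F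

  pattern p-D   = 0F
  pattern q-D   = 1F
  pattern p-J   = 2F
  pattern q-J   = 3F
  pattern e     = 4F
  pattern f-D   = 5F
  pattern f-J   = 6F
  pattern r     = 7F
  pattern s-top = 8F
  pattern s-bot = 9F

  step : Fin 3 → Fin 10 → Maybe (Fin 3 × Fin 10)
  step O p-D = just (D , q-D)
  step O p-J = just (J , q-J)
  step O r   = just (O , s-top)
  step D e   = just (O , f-D)
  step D r   = just (O , s-top)
  step J e   = just (O , f-J)
  step J r   = just (O , s-bot)
  step _ _   = nothing

module UPDSDS where
  pattern up   = 0F
  pattern down = 1F

  pattern t-in    = 0F
  pattern t-out   = 1F
  pattern x₁      = 2F
  pattern y₁-up   = 3F
  pattern y₁-down = 4F
  pattern x₂      = 5F
  pattern y₂-up   = 6F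
  pattern y₂-down = 7F

  step : Fin 2 → Fin 8 → Maybe (Fin 2 × Fin 8)
  step _    t-in = just (up   , t-out)
  step up   x₁   = just (down , y₁-up)
  step down x₁   = just (down , y₁-down)
  step up   x₂   = just (down , y₂-up)
  step down x₂   = just (down , y₂-down)
  step _    _    = nothing

increment register updsds : Gadget
increment = record { transition = Increment.step }
register  = record { transition = Register.step }
updsds    = record { transition = UPDSDS.step }

------------------------------------------------------------------------
-- Systems built from spawners and copies of the gadgets in Γ

module _ {k : ℕ} (Γ : Vec Gadget k) where

  -- A copy of a gadget of Γ, with its initial state.
  Copy : Set
  Copy = Σ[ i ∈ Fin k ] Fin (#states (lookup Γ i))

  module _ (gadgets : List Copy) where

    gadgetAt : Fin (length gadgets) → Gadget
    gadgetAt i = lookup Γ (proj₁ (List.lookup gadgets i))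

    -- The single location of a spawner, or a location of a gadget.
    Loc : ℕ → Set
    Loc #spawners = Fin #spawners ⊎ (Σ[ i ∈ Fin (length gadgets) ] Fin (#locations (gadgetAt i)))

  record System : Set where
    field
      gadgets   : List Copy
      -- The spawners spawn in the order of their numbers.
      #spawners : ℕ

    Location : Set
    Location = Loc gadgets #spawners

    field
      -- (a , b) is the connection directed from a to b.
      edges       : List (Location × Location)
      .outdegree  : Unique (List.map proj₁ edges)
      .one-way    : All (λ e → proj₂ e ∉ List.map proj₁ edges) edges

    _≟_ : DecidableEquality Location
    _≟_ = Sum.≡-dec _≟ᶠ_ (Product.≡-dec _≟ᶠ_ _≟ᶠ_)

    -- The head of an edge has no outgoing edge, so a robot follows at most one
    -- edge before it has to traverse a gadget or stop.
    follow : Location → Location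
    follow a =
      fromMaybe a (head (List.map proj₂ (filter (λ e → proj₁ e ≟ a) edges)))

    States : Set
    States = (i : Fin (length gadgets)) → Fin (#states (gadgetAt gadgets i))

    initial : States
    initial i = proj₂ (List.lookup gadgets i)

    set : (i : Fin (length gadgets)) → Fin (#states (gadgetAt gadgets i)) →
          States → States
    set i s σ j with i ≟ᶠ j
    ... | yes refl = s
    ... | no  _    = σ j

    traverse : States → Location → States × Location
    traverse σ (inj₁ s) = σ , inj₁ s
    traverse σ (inj₂ (i , a)) with transition (gadgetAt gadgets i) (σ i) a
    ... | nothing      = σ , inj₂ (i , a)
    ... | just (s , b) = set i s σ , inj₂ (i , b)

    turn : States → Location → States × Location
    turn σ a = traverse σ (follow a)

    turns : States → List Location → States × List Location
    turns σ []       = σ , []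
    turns σ (a ∷ as) =
      let σ₁ , a′  = turn σ a
          σ₂ , as′ = turns σ₁ as
      in  σ₂ , a′ ∷ as′

    -- The gadget states, and the positions of the robots in spawning order.
    Config : Set
    Config = States × List Location

    round : Config → Config
    round (σ , robots) =
      let σ′ , robots′ = turns σ robots
      in  σ′ , robots′ ++ List.map inj₁ (allFin #spawners)

    after : ℕ → Config
    after zero    = initial , []
    after (suc t) = round (after t)

    -- In the round following `after t`, a robot standing at a passes
    -- through follow a, where it need not come to rest.
    Reached : Location → Set
    Reached target =
      ∃[ t ] ∃[ a ] a ∈ proj₂ (after t) × (target ≡ a ⊎ target ≡ follow a)

  Instance : Set
  Instance = Σ[ S ∈ System ] System.Location S

  RobotReachability : Instance → Set
  RobotReachability (S , target) = System.Reached S target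

  code-Loc : (gs : List Copy) (n : ℕ) → Loc gs n ↣ ℕ
  code-Loc gs n = code-⊎ (code-Fin n) (code-Σ (code-Fin _) (λ i → code-Fin _))

  -- A system without the proofs that it is well-formed.
  Raw : Set
  Raw = Σ[ gs ∈ List Copy ] Σ[ n ∈ ℕ ] List (Loc gs n × Loc gs n)

  raw : System → Raw
  raw S = System.gadgets S , System.#spawners S , System.edges S

  raw-injective : ∀ {S S′} → raw S ≡ raw S′ → S ≡ S′
  raw-injective refl = refl

  code-Raw : Raw ↣ ℕ
  code-Raw =
    code-Σ (code-List (code-Σ (code-Fin k) (λ i → code-Fin _))) λ gs →
    code-Σ code-ℕ λ n →
    code-List (code-Σ (code-Loc gs n) (λ _ → code-Loc gs n))

  code-System : System ↣ ℕ
  code-System = mk↣ {to = Injection.to code-Raw ∘ raw}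
    (λ eq → raw-injective (Injection.injective code-Raw eq))

  code-Instance : Instance ↣ ℕ
  code-Instance =
    code-Σ code-System (λ S → code-Loc (System.gadgets S) (System.#spawners S))

{-# OPTIONS --safe #-}
module Submission where

-- A partial recursive function is compiled to a counter machine, and the machine
-- to gadgets.  The value of a counter is the number of robots waiting at the
-- processing branch of its register gadget.  A single robot, the first of the
-- first spawner, executes the program.  To increment, it passes an increment
-- gadget, which then releases one robot of a spawner's queue to the register.
-- To test and decrement, it passes the path J: in the same round the register
-- discards a waiting robot and resets itself if there is one, so that the
-- response branch in the next round tells whether there was.  As a register is
-- tested at many places of the program, the robot first raises the UPDSDS gadget
-- of the current instruction and afterwards walks along all UPDSDS gadgets until
-- it meets the raised one.  The input n is encoded by n increment gadgets that
-- are open initially and release one robot each; nothing else depends on n, so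
-- the code of the system is a simple recursive function of n.

open import Data.Bool.Base using (Bool; true; false; T)
open import Data.Bool.Properties using (T?)
open import Data.Fin.Base as Fin using (Fin; toℕ; fromℕ; fromℕ<; inject₁; _↑ˡ_; _↑ʳ_; splitAt)
open import Data.Fin.Patterns
open import Data.Fin.Properties as Finₚ
  using (toℕ-injective; toℕ<n; toℕ-fromℕ; toℕ-fromℕ<; fromℕ<-toℕ; toℕ-inject₁; toℕ-↑ˡ; toℕ-↑ʳ)
open import Data.List.Base as List
  using ( List; []; _∷_; _++_; _ʳ++_; length; map; filter; foldr; allFin; tabulate; replicate
        ; cartesianProductWith; downFrom)
open import Data.List.Membership.Propositional using (_∈_; _∉_)
open import Data.List.Membership.Propositional.Properties
open import Data.List.Properties
  using ( length-++; length-ʳ++; length-map; length-tabulate; ++-assoc; map-++; map-∘; map-cong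
        ; map-tabulate; foldr-++)
open import Data.List.Relation.Binary.Pointwise as Pw using (Pointwise; []; _∷_)
open import Data.List.Relation.Unary.All as All using (All; []; _∷_)
import Data.List.Relation.Unary.All.Properties as Allₚ
open import Data.List.Relation.Unary.AllPairs using ([]; _∷_)
open import Data.List.Relation.Unary.Any using (here; there)
open import Data.List.Relation.Unary.Unique.Propositional using (Unique)
import Data.List.Relation.Unary.Unique.Propositional.Properties as Unique
open import Data.Maybe.Base as Maybe using (Maybe; just; nothing; fromMaybe; is-just)
open import Data.Nat.Base using (ℕ; zero; suc; _+_; _≤_; _<_; _⊔_; z≤n; s≤s; s≤s⁻¹)
open import Data.Nat.Properties
  using ( _≟_; _<?_; ≤-refl; ≤-reflexive; ≤-trans; <-trans; <-≤-trans; <-irrefl; <⇒≢; <⇒≱; ≮⇒≥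
        ; n≤1+n; n<1+n; m≤n+m; m<m+n; m≤n⇒m≤1+n; m<n⇒m<1+n; m≤n⇒m<n∨m≡n; m≤m⊔n; m≤n⊔m
        ; +-suc; +-comm; +-assoc; +-identityʳ; +-cancelˡ-≡)
open import Data.Product.Base using (Σ-syntax; ∃-syntax; _×_; _,_; proj₁; proj₂)
open import Data.Sum.Base using (_⊎_; inj₁; inj₂)
open import Data.Sum.Properties using (inj₁-injective; inj₂-injective)
open import Data.Unit.Base using (⊤; tt)
open import Data.Vec.Base as Vec using (Vec; []; _∷_; head; tail; lookup; toList)
open import Data.Vec.Properties using (length-toList)
open import Data.Vec.Relation.Binary.Pointwise.Inductive as VecPw using ([]; _∷_)
open import Data.Vec.Relation.Unary.All as VecAll using ([]; _∷_)
import Data.Vec.Relation.Unary.All.Properties as VecAllₚ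
open import Function.Base using (_∘_; id; const)
open import Function.Bundles using (_⇔_; _↣_; mk⇔; module Injection)
open import Function.Construct.Composition using (_⇔-∘_)
open import Function.Construct.Symmetry using (⇔-sym)
open import Relation.Binary.Definitions using (DecidableEquality)
open import Relation.Binary.PropositionalEquality
open import Relation.Nullary using (Dec; yes; no; ¬_; contradiction)
open import Relation.Nullary.Decidable using (map′)
open import Defs

-- Computable functions

-- Everything rests on the turn order. The program robot is the oldest, so it moves first in each
-- round: a lock that it opens is passed by the oldest robot waiting there in the same round and is
-- shut by that passage, before a second robot can use it. Hence all gadgets are in one fixed state
-- whenever an instruction begins, and the counters alone describe the configuration, although new
-- robots arrive at the increment gadgets in every round. Path `J` does the testing because the
-- response branch tells state `J` from the original state, whereas `D` and the original state give
-- the same answer. Loading the input by instructions would put n into the addresses and so all over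
-- the wiring; gates, numbered after all other gadgets, leave every other gadget number unchanged.
-- Both directions of the equivalence are needed: a run of the gadgets that hits the target must
-- yield a halting run of the machine, and that a value of the function. Stores and gadget states
-- are functions and are compared pointwise.

Total : ∀ {k} → (Vec ℕ k → ℕ) → Set
Total {k} F = Σ[ c ∈ PR k ] ∀ xs → c [ xs ]⇓ F xs

module _ {k : ℕ} where

  total-const : ∀ a → Total {k} (λ _ → a)
  total-const zero    = comp zero′ [] , λ _ → comp⇓ [] zero⇓
  total-const (suc a) with total-const a
  ... | c , c⇓ = comp suc′ (c ∷ []) , λ xs → comp⇓ (c⇓ xs ∷ []) suc⇓

  total-suc : ∀ {F : Vec ℕ k → ℕ} → Total F → Total (λ xs → suc (F xs))
  total-suc (c , c⇓) = comp suc′ (c ∷ []) , λ xs → comp⇓ (c⇓ xs ∷ []) suc⇓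

  total-∘₁ : ∀ {G : ℕ → ℕ} {F : Vec ℕ k → ℕ} →
             Total {1} (λ xs → G (head xs)) → Total F → Total (λ xs → G (F xs))
  total-∘₁ (g , g⇓) (c , c⇓) =
    comp g (c ∷ []) , λ xs → comp⇓ (c⇓ xs ∷ []) (g⇓ (_ ∷ []))

  total-∘₂ : ∀ {G : ℕ → ℕ → ℕ} {F H : Vec ℕ k → ℕ} →
             Total {2} (λ xs → G (head xs) (head (tail xs))) → Total F → Total H →
             Total (λ xs → G (F xs) (H xs))
  total-∘₂ (g , g⇓) (c , c⇓) (d , d⇓) =
    comp g (c ∷ d ∷ []) , λ xs → comp⇓ (c⇓ xs ∷ d⇓ xs ∷ []) (g⇓ (_ ∷ _ ∷ []))

total-head : ∀ {k} → Total {suc k} head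
total-head = proj 0F , λ { (_ ∷ _) → proj⇓ }

total-second : ∀ {k} → Total {suc (suc k)} (λ xs → head (tail xs))
total-second = proj 1F , λ { (_ ∷ _ ∷ _) → proj⇓ }

-- `F` is an existing function together with its two recursion equations, so that `_+_` and
-- `triangle` are covered as they stand.
total-rec : ∀ {k} {F : ℕ → Vec ℕ k → ℕ} {B : Vec ℕ k → ℕ} {G : ℕ → ℕ → ℕ} →
            Total B → Total {2} (λ xs → G (head xs) (head (tail xs))) →
            (∀ xs → F 0 xs ≡ B xs) → (∀ i xs → F (suc i) xs ≡ G i (F i xs)) →
            Total (λ xs → F (head xs) (tail xs))
total-rec {F = F} {B} {G} (b , b⇓) Gt F0 Fs =
  rec b (proj₁ step) , λ { (i ∷ xs) → go i xs }
  where
  step : Total (λ xs → G (head xs) (head (tail xs)))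
  step = total-∘₂ {G = G} Gt total-head total-second
  go : ∀ i xs → rec b (proj₁ step) [ i ∷ xs ]⇓ F i xs
  go zero    xs rewrite F0 xs   = rec⇓0 (b⇓ xs)
  go (suc i) xs rewrite Fs i xs = rec⇓s (go i xs) (proj₂ step (i ∷ _ ∷ xs))

total-+ : ∀ {k} {F H : Vec ℕ k → ℕ} → Total F → Total H → Total (λ xs → F xs + H xs)
total-+ = total-∘₂ {G = _+_}
  (total-rec {F = λ x ys → x + head ys} {G = λ _ z → suc z}
    total-head (total-suc total-second) (λ _ → refl) (λ _ _ → refl))

total-triangle : ∀ {k} {F : Vec ℕ k → ℕ} → Total F → Total (λ xs → triangle (F xs))
total-triangle = total-∘₁ {G = triangle}
  (total-rec {F = λ x _ → triangle x} {G = λ i z → suc i + z}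
    (total-const 0) (total-+ (total-suc total-head) total-second)
    (λ _ → refl) (λ _ _ → refl))

total-pair : ∀ {k} {F H : Vec ℕ k → ℕ} → Total F → Total H → Total (λ xs → pair (F xs) (H xs))
total-pair F H = total-+ (total-triangle (total-+ F H)) H

consCode : ℕ → ℕ → ℕ
consCode x y = suc (pair x y)

total-consCode : ∀ {k} {F H : Vec ℕ k → ℕ} → Total F → Total H →
                 Total (λ xs → consCode (F xs) (H xs))
total-consCode F H = total-suc (total-pair F H)

total-foldr : ∀ {k} {F : Vec ℕ k → ℕ} (as : List ℕ) → Total F →
              Total (λ xs → foldr consCode (F xs) as)
total-foldr []       F = F
total-foldr (a ∷ as) F = total-consCode (total-const a) (total-foldr as F)

-- `F 0` is an arbitrary number: the code of all that does not depend on the input enters as a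
-- constant.
total-iterate : ∀ {F : ℕ → ℕ} {G : ℕ → ℕ → ℕ} →
                Total {2} (λ xs → G (head xs) (head (tail xs))) →
                (∀ i → F (suc i) ≡ G i (F i)) →
                Total {1} (λ xs → F (head xs))
total-iterate {F} {G} Gt Fs =
  total-rec {F = λ x _ → F x} {G = G} (total-const (F 0)) Gt (λ _ → refl) (λ i _ → Fs i)

computable : ∀ {F : ℕ → ℕ} → Total {1} (λ xs → F (head xs)) → Computable F
computable (c , c⇓) = c , λ n → c⇓ (n ∷ [])

-- From partial recursive functions to counter programs

-- Unlike the Boolean conditional on does d, a with-abstraction over d decides it.
infix 0 if_then_else_

if_then_else_ : ∀ {P A : Set} → Dec P → A → A → A
if yes _ then a else b = a
if no  _ then a else b = b

Store : Set
Store = ℕ → ℕ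

infixl 9 _[_↦_]

_[_↦_] : Store → ℕ → ℕ → Store
(ρ [ r ↦ v ]) j = if j ≟ r then v else ρ j

infixr 5 _；_

data Cmd : Set where
  inc  : ℕ → Cmd
  _；_ : Cmd → Cmd → Cmd
  loop : ℕ → Cmd → Cmd

infix 4 _⊢_⇒_

data _⊢_⇒_ : Cmd → Store → Store → Set where
  inc  : ∀ {r ρ} → inc r ⊢ ρ ⇒ ρ [ r ↦ suc (ρ r) ]
  _；_ : ∀ {P Q ρ ρ₁ ρ₂} → P ⊢ ρ ⇒ ρ₁ → Q ⊢ ρ₁ ⇒ ρ₂ → P ； Q ⊢ ρ ⇒ ρ₂
  done : ∀ {r P ρ} → ρ r ≡ 0 → loop r P ⊢ ρ ⇒ ρ
  more : ∀ {r P ρ ρ₁ ρ₂ k} → ρ r ≡ suc k →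
         P ⊢ ρ [ r ↦ k ] ⇒ ρ₁ → loop r P ⊢ ρ₁ ⇒ ρ₂ → loop r P ⊢ ρ ⇒ ρ₂

⇒-deterministic : ∀ {P ρ ρ₁ ρ₂} → P ⊢ ρ ⇒ ρ₁ → P ⊢ ρ ⇒ ρ₂ → ρ₁ ≡ ρ₂
⇒-deterministic inc inc = refl
⇒-deterministic (p ； q) (p′ ； q′) with ⇒-deterministic p p′
... | refl = ⇒-deterministic q q′
⇒-deterministic (done _) (done _) = refl
⇒-deterministic (done e) (more e′ _ _) with () ← trans (sym e) e′
⇒-deterministic (more e′ _ _) (done e) with () ← trans (sym e) e′
⇒-deterministic (more e p q) (more e′ p′ q′) with trans (sym e) e′
... | refl with ⇒-deterministic p p′
... | refl = ⇒-deterministic q q′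

-- A stack, top first, fills the registers from 0 upwards, so that pushing does
-- not renumber; the registers above the top hold 0.
reg : List ℕ → Store
reg []      j = 0
reg (x ∷ s) j = if j ≟ length s then x else reg s j

reg-free : ∀ s {j} → length s ≤ j → reg s j ≡ 0
reg-free []      le = refl
reg-free (x ∷ s) {j} le with j ≟ length s
... | yes refl = contradiction le (<-irrefl refl)
... | no  _    = reg-free s (≤-trans (n≤1+n _) le)

infix 4 _≅_

_≅_ : List ℕ → List ℕ → Set
s ≅ s′ = reg s ≗ reg s′

-- Unallocated registers hold 0, so reserving one leaves the store as it is. Scratch registers are
-- opened and closed this way.
0∷-≅ : ∀ s → 0 ∷ s ≅ s
0∷-≅ s j with j ≟ length s
... | yes refl = sym (reg-free s ≤-refl)
... | no  _    = refl

length-mid : ∀ a (x y : ℕ) b → length (a ++ x ∷ b) ≡ length (a ++ y ∷ b)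
length-mid a x y b = trans (length-++ a) (sym (length-++ a))

mid<length : ∀ a (x : ℕ) b → length b < length (a ++ x ∷ b)
mid<length a x b rewrite length-++ a {x ∷ b} = m≤n+m _ (length a)

reg-mid : ∀ a x b → reg (a ++ x ∷ b) (length b) ≡ x
reg-mid [] x b with length b ≟ length b
... | yes _ = refl
... | no ≢  = contradiction refl ≢
reg-mid (y ∷ a) x b with length b ≟ length (a ++ x ∷ b)
... | yes e = contradiction e (<⇒≢ (mid<length a x b))
... | no  _ = reg-mid a x b

update-mid : ∀ a x {v} b {ρ} → ρ ≗ reg (a ++ x ∷ b) →
             ρ [ length b ↦ v ] ≗ reg (a ++ v ∷ b)
update-mid [] x b e j with j ≟ length b | e j
... | yes _ | _  = refl
... | no  _ | e′ = e′
update-mid (y ∷ a) x {v} b {ρ} e j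
  with j ≟ length (a ++ v ∷ b) | j ≟ length b | e j | update-mid a x {v} b {reg (a ++ x ∷ b)} (λ _ → refl) j
... | yes j≡ | yes j≡b | _  | _  = contradiction (trans (sym j≡b) j≡) (<⇒≢ (mid<length a v b))
... | no _   | yes _   | _  | IH = IH
... | yes j≡ | no _    | e′ | _  with j ≟ length (a ++ x ∷ b)
...   | yes _ = e′
...   | no ≢  = contradiction (trans j≡ (length-mid a v x b)) ≢
update-mid (y ∷ a) x {v} b {ρ} e j | no ≢ | no _ | e′ | IH with j ≟ length (a ++ x ∷ b)
...   | yes j≡ = contradiction (trans j≡ (length-mid a x v b)) ≢
...   | no _   = trans e′ IH

-- Specifications of commands on stacks of registers

infix 4 _∶_⟹_

record _∶_⟹_ (P : Cmd) (s s′ : List ℕ) : Set where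
  constructor spec
  field run : ∀ {ρ} → ρ ≗ reg s → ∃[ ρ′ ] P ⊢ ρ ⇒ ρ′ × ρ′ ≗ reg s′

open _∶_⟹_

≅-⟹ : ∀ {P s s′ t} → P ∶ s ⟹ s′ → t ≅ s → P ∶ t ⟹ s′
≅-⟹ p t≅s .run ρ≗ = run p (λ j → trans (ρ≗ j) (t≅s j))

⟹-≅ : ∀ {P s s′ t} → P ∶ s ⟹ s′ → s′ ≅ t → P ∶ s ⟹ t
⟹-≅ p s′≅t .run ρ≗ with run p ρ≗
... | ρ′ , p⇒ , ρ′≗ = ρ′ , p⇒ , λ j → trans (ρ′≗ j) (s′≅t j)

-- Determinism turns the existence of one run with a known result into a statement about every run.
⟹-unique : ∀ {P s s′ ρ ρ′} → P ∶ s ⟹ s′ → ρ ≗ reg s → P ⊢ ρ ⇒ ρ′ → ρ′ ≗ reg s′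
⟹-unique p ρ≗ p⇒ with run p ρ≗
... | ρ″ , p⇒′ , ρ″≗ with ⇒-deterministic p⇒ p⇒′
... | refl = ρ″≗

infixr 5 _⨾_

_⨾_ : ∀ {P Q s s₁ s₂} → P ∶ s ⟹ s₁ → Q ∶ s₁ ⟹ s₂ → P ； Q ∶ s ⟹ s₂
(p ⨾ q) .run ρ≗ with run p ρ≗
... | ρ₁ , p⇒ , ρ₁≗ with run q ρ₁≗
... | ρ₂ , q⇒ , ρ₂≗ = ρ₂ , p⇒ ； q⇒ , ρ₂≗

inc-mid : ∀ a x b {r} → r ≡ length b → inc r ∶ a ++ x ∷ b ⟹ a ++ suc x ∷ b
inc-mid a x b refl .run {ρ} ρ≗ = _ , inc ,
  subst (λ v → ρ [ length b ↦ suc v ] ≗ reg (a ++ suc x ∷ b))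
        (sym (trans (ρ≗ (length b)) (reg-mid a x b))) (update-mid a x b ρ≗)

loop-done : ∀ a b {r P} → r ≡ length b → loop r P ∶ a ++ 0 ∷ b ⟹ a ++ 0 ∷ b
loop-done a b refl .run ρ≗ = _ , done (trans (ρ≗ (length b)) (reg-mid a 0 b)) , ρ≗

loop-more : ∀ a k b {r P s₁ s₂} → r ≡ length b →
            P ∶ a ++ k ∷ b ⟹ s₁ → loop r P ∶ s₁ ⟹ s₂ → loop r P ∶ a ++ suc k ∷ b ⟹ s₂
loop-more a k b refl p q .run ρ≗ with run p (update-mid a (suc k) b ρ≗)
... | ρ₁ , p⇒ , ρ₁≗ with run q ρ₁≗
... | ρ₂ , q⇒ , ρ₂≗ = ρ₂ , more (trans (ρ≗ (length b)) (reg-mid a (suc k) b)) p⇒ q⇒ , ρ₂≗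

-- `Cmd` has no empty command. This loop exits at once if register `z` holds 0 and never otherwise,
-- so `z` must be free.
nop : ℕ → Cmd
nop z = loop z (inc z)

nop-free : ∀ s {z} → z ≡ length s → nop z ∶ s ⟹ s
nop-free s refl .run ρ≗ = _ , done (trans (ρ≗ (length s)) (reg-free s ≤-refl)) , ρ≗

clear : ℕ → ℕ → Cmd
clear r z = loop r (nop z)

clear-mid : ∀ a v b {r z} → r ≡ length b → z ≡ length (a ++ v ∷ b) →
            clear r z ∶ a ++ v ∷ b ⟹ a ++ 0 ∷ b
clear-mid a zero    b r≡ z≡ = loop-done a b r≡
clear-mid a (suc v) b r≡ z≡ =
  loop-more a v b r≡ (nop-free (a ++ v ∷ b) z≡′) (clear-mid a v b r≡ z≡′)
  where z≡′ = trans z≡ (length-mid a (suc v) v b)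

move : ℕ → ℕ → Cmd
move r t = loop r (inc t)

move-top : ∀ v a w b {r t} → r ≡ length (a ++ w ∷ b) → t ≡ length b →
           move r t ∶ v ∷ a ++ w ∷ b ⟹ 0 ∷ a ++ (v + w) ∷ b
move-top zero    a w b r≡ t≡ = loop-done [] (a ++ w ∷ b) r≡
move-top (suc v) a w b {r} {t} r≡ t≡ =
  loop-more [] v (a ++ w ∷ b) r≡ (inc-mid (v ∷ a) w b t≡)
    (subst (λ u → move r t ∶ v ∷ a ++ suc w ∷ b ⟹ 0 ∷ a ++ u ∷ b)
           (+-suc v w) (move-top v a (suc w) b (trans r≡ (length-mid a w (suc w) b)) t≡))

data _∋_↦_ : List ℕ → ℕ → ℕ → Set where
  slot : ∀ a {v b} → (a ++ v ∷ b) ∋ length b ↦ v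

weaken : ∀ {s x v} y → s ∋ x ↦ v → (y ∷ s) ∋ x ↦ v
weaken y (slot a) = slot (y ∷ a)

-- Reading a register destroys it: the value is moved to the scratch register `suc d` and from there
-- back into both `x` and `d`.
add : ℕ → ℕ → Cmd
add x d = move x (suc d) ； loop (suc d) (inc x ； inc d)

add-spec : ∀ {s x v} → s ∋ x ↦ v → add x (length s) ∶ s ⟹ v ∷ s
add-spec (slot a {v} {b}) =
  ≅-⟹ (⟹-≅ (out v 0 (length-mid a v 0 b) ⨾ back v refl)
            (λ j → trans (0∷-≅ (v + 0 ∷ a ++ v + 0 ∷ b) j)
                         (cong (λ w → reg (w ∷ a ++ w ∷ b) j) (+-identityʳ v))))
      (λ j → sym (trans (0∷-≅ (0 ∷ a ++ v ∷ b) j) (0∷-≅ (a ++ v ∷ b) j)))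
  where
  out : ∀ v t {d} → d ≡ length (a ++ 0 ∷ b) →
        move (length b) (suc d) ∶ t ∷ 0 ∷ a ++ v ∷ b ⟹ v + t ∷ 0 ∷ a ++ 0 ∷ b
  out zero    t d≡ = loop-done (t ∷ 0 ∷ a) b refl
  out (suc v) t {d} d≡ =
    loop-more (t ∷ 0 ∷ a) v b refl
      (inc-mid [] t (0 ∷ a ++ v ∷ b) (cong suc (trans d≡ (length-mid a 0 v b))))
      (subst (λ u → move (length b) (suc d) ∶ suc t ∷ 0 ∷ a ++ v ∷ b ⟹ u ∷ 0 ∷ a ++ 0 ∷ b)
             (+-suc v t) (out v (suc t) d≡))

  back′ : ∀ v w {d} → d ≡ length (a ++ w ∷ b) →
          loop (suc d) (inc (length b) ； inc d) ∶ v ∷ w ∷ a ++ w ∷ b ⟹ 0 ∷ v + w ∷ a ++ v + w ∷ b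
  back′ zero    w d≡ = loop-done [] (w ∷ a ++ w ∷ b) (cong suc d≡)
  back′ (suc v) w {d} d≡ = loop-more [] v (w ∷ a ++ w ∷ b) (cong suc d≡)
    (inc-mid (v ∷ w ∷ a) w b refl ⨾ inc-mid (v ∷ []) w (a ++ suc w ∷ b) d≡′)
    (subst (λ u → loop (suc d) (inc (length b) ； inc d) ∶ v ∷ suc w ∷ a ++ suc w ∷ b ⟹ 0 ∷ u ∷ a ++ u ∷ b)
           (+-suc v w) (back′ v (suc w) d≡′))
    where d≡′ = trans d≡ (length-mid a w (suc w) b)

  back : ∀ v {d} → d ≡ length (a ++ v ∷ b) →
         loop (suc d) (inc (length b) ； inc d) ∶ v + 0 ∷ 0 ∷ a ++ 0 ∷ b ⟹ 0 ∷ v + 0 ∷ a ++ v + 0 ∷ b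
  back v {d} d≡ =
    subst (λ u → loop (suc d) (inc (length b) ； inc d) ∶ u ∷ 0 ∷ a ++ 0 ∷ b ⟹ 0 ∷ v + 0 ∷ a ++ v + 0 ∷ b)
          (sym (+-identityʳ v)) (back′ v 0 (trans d≡ (length-mid a v 0 b)))

levels : ℕ → ∀ m → Vec ℕ m
levels e zero    = []
levels e (suc m) = e ∷ levels (suc e) m

-- From the top down, so that the register above the one being cleared is free for `nop`.
clears : ℕ → ℕ → Cmd
clears zero    e = nop e
clears (suc m) e = clears m (suc e) ； clear e (suc e)

mutual
  -- ⟦ f ⟧ ins d reads its arguments from the registers ins < d and leaves its
  -- value in register d, restoring everything else.
  ⟦_⟧ : ∀ {n} → PR n → Vec ℕ n → ℕ → Cmd
  ⟦ zero′ ⟧ _ d = nop d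
  ⟦ suc′ ⟧ (x ∷ []) d = add x d ； inc d
  ⟦ proj i ⟧ ins d = add (lookup ins i) d
  -- Register `d` is kept at 0 for the result, the values of `gs` lie above it, and the value of `f`
  -- appears above those.
  ⟦ comp {m} f gs ⟧ ins d =
    ⟦ gs ⟧* ins (suc d) ； ⟦ f ⟧ (levels (suc d) m) (m + suc d) ；
    move (m + suc d) d ； clears m (suc d)
  -- Register `d` is the accumulator, `1 + d` the number of iterations still to do, `2 + d` the
  -- index passed to `g`, and `3 + d` the new value.
  ⟦ rec f g ⟧ (k ∷ ins) d =
    ⟦ f ⟧ ins d ； add k (1 + d) ；
    loop (1 + d) (⟦ g ⟧ (2 + d ∷ d ∷ ins) (3 + d) ； clear d (4 + d) ； move (3 + d) d ； inc (2 + d)) ；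
    clear (2 + d) (3 + d)
  -- Register `d` is the candidate, `1 + d` tells whether to go on, and `2 + d` is the value of `f`.
  -- The inner loop clears the register it tests and so is a conditional.
  ⟦ μ f ⟧ ins d =
    inc (1 + d) ；
    loop (1 + d) (⟦ f ⟧ (d ∷ ins) (2 + d) ；
                  loop (2 + d) (clear (2 + d) (3 + d) ； inc (1 + d) ； inc d))

  ⟦_⟧* : ∀ {m n} → Vec (PR n) m → Vec ℕ n → ℕ → Cmd
  ⟦ [] ⟧* _ d = nop d
  ⟦ g ∷ gs ⟧* ins d = ⟦ g ⟧ ins d ； ⟦ gs ⟧* ins (suc d)

-- Correctness of the compiler in both directions

Args : ∀ {n} → List ℕ → Vec ℕ n → Vec ℕ n → Set
Args s = VecPw.Pointwise (s ∋_↦_)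

weaken-args : ∀ {n s} {ins xs : Vec ℕ n} y → Args s ins xs → Args (y ∷ s) ins xs
weaken-args y = VecPw.map (weaken y)

-- `complete` extracts a value from a terminating run. Its proofs use `sound` for the parts already
-- run, to learn the store in which the next part starts.
record Correct {n} (f : PR n) : Set where
  field
    sound    : ∀ {xs y} s ins → Args s ins xs → f [ xs ]⇓ y → ⟦ f ⟧ ins (length s) ∶ s ⟹ y ∷ s
    complete : ∀ {xs ρ ρ′} s ins → Args s ins xs → ρ ≗ reg s →
               ⟦ f ⟧ ins (length s) ⊢ ρ ⇒ ρ′ → ∃[ y ] f [ xs ]⇓ y

open Correct

zero-correct : Correct zero′
zero-correct .sound s ins as zero⇓ = ⟹-≅ (nop-free s refl) (λ j → sym (0∷-≅ s j))
zero-correct .complete {[]} _ _ _ _ _ = 0 , zero⇓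

suc-correct : Correct suc′
suc-correct .sound s (x ∷ []) (a ∷ []) suc⇓ = add-spec a ⨾ inc-mid [] _ s refl
suc-correct .complete {x ∷ []} _ _ _ _ _ = suc x , suc⇓

proj-correct : ∀ {n} (i : Fin n) → Correct (proj i)
proj-correct i .sound s ins as proj⇓ = add-spec (VecPw.lookup as i)
proj-correct i .complete _ _ _ _ _ = _ , proj⇓

data Corrects {n} : ∀ {m} → Vec (PR n) m → Set where
  []  : Corrects []
  _∷_ : ∀ {m g} {gs : Vec (PR n) m} → Correct g → Corrects gs → Corrects (g ∷ gs)

-- The values are pushed in the order of the vector, so the first one lies deepest; hence the
-- reversing append.
sounds : ∀ {m n} {gs : Vec (PR n) m} {xs} {zs : Vec ℕ m} → Corrects gs → ∀ s ins → Args s ins xs →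
         VecPw.Pointwise (λ g z → g [ xs ]⇓ z) gs zs →
         ⟦ gs ⟧* ins (length s) ∶ s ⟹ toList zs ʳ++ s
sounds [] s ins as [] = nop-free s refl
sounds (c ∷ cs) s ins as (_∷_ {y = z} p ps) =
  sound c s ins as p ⨾ sounds cs (z ∷ s) ins (weaken-args z as) ps

completes : ∀ {m n} {gs : Vec (PR n) m} {xs ρ ρ′} → Corrects gs → ∀ s ins → Args s ins xs →
            ρ ≗ reg s → ⟦ gs ⟧* ins (length s) ⊢ ρ ⇒ ρ′ →
            Σ[ zs ∈ Vec ℕ m ] VecPw.Pointwise (λ g z → g [ xs ]⇓ z) gs zs
completes [] s ins as ρ≗ _ = [] , []
completes (c ∷ cs) s ins as ρ≗ (p ； ps) with complete c s ins as ρ≗ p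
... | z , z⇓ with completes cs (z ∷ s) ins (weaken-args z as) (⟹-unique (sound c s ins as z⇓) ρ≗ p) ps
... | zs , zs⇓ = z ∷ zs , z⇓ ∷ zs⇓

at-ʳ++ : ∀ {s x v} (zs : List ℕ) → s ∋ x ↦ v → (zs ʳ++ s) ∋ x ↦ v
at-ʳ++ []       a = a
at-ʳ++ (z ∷ zs) a = at-ʳ++ zs (weaken z a)

args-levels : ∀ {m} (zs : Vec ℕ m) s → Args (toList zs ʳ++ s) (levels (length s) m) zs
args-levels []       s = []
args-levels (z ∷ zs) s = at-ʳ++ (toList zs) (slot []) ∷ args-levels zs (z ∷ s)

clears-spec : ∀ {m} (zs : Vec ℕ m) s → clears m (length s) ∶ toList zs ʳ++ s ⟹ s
clears-spec []       s = nop-free s refl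
clears-spec (z ∷ zs) s = clears-spec zs (z ∷ s) ⨾ ⟹-≅ (clear-mid [] z s refl refl) (0∷-≅ s)

length-args : ∀ {m} (zs : Vec ℕ m) s → length (toList zs ʳ++ s) ≡ m + length s
length-args zs s = trans (length-ʳ++ (toList zs)) (cong (_+ length s) (length-toList zs))

ʳ++-++-assoc : ∀ (zs s t : List ℕ) → (zs ʳ++ s) ++ t ≡ zs ʳ++ (s ++ t)
ʳ++-++-assoc []       s t = refl
ʳ++-++-assoc (z ∷ zs) s t = ʳ++-++-assoc zs (z ∷ s) t

comp-correct : ∀ {m n} {f : PR m} {gs : Vec (PR n) m} → Correct f → Corrects gs → Correct (comp f gs)
comp-correct {m} {f = f} {gs} cf cgs = record
  { sound = λ { s ins as (comp⇓ {ys = zs} zs⇓ y⇓) →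
      ≅-⟹ (sounds cgs (0 ∷ s) ins (weaken-args 0 as) zs⇓ ⨾ sound-f s zs y⇓ ⨾
            move-down s zs ⨾ clears-spec zs (_ ∷ s))
          (λ j → sym (0∷-≅ s j)) }
  ; complete = comp-complete
  }
  where
  sound-f : ∀ s zs {y} → f [ zs ]⇓ y →
            ⟦ f ⟧ (levels (suc (length s)) m) (m + suc (length s)) ∶
              toList zs ʳ++ (0 ∷ s) ⟹ y ∷ (toList zs ʳ++ (0 ∷ s))
  sound-f s zs {y} y⇓ =
    subst (λ l → ⟦ f ⟧ (levels (suc (length s)) m) l ∶
                   toList zs ʳ++ (0 ∷ s) ⟹ y ∷ (toList zs ʳ++ (0 ∷ s)))
          (length-args zs (0 ∷ s))
          (sound cf (toList zs ʳ++ (0 ∷ s)) _ (args-levels zs (0 ∷ s)) y⇓)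

  move-down : ∀ s zs {y} →
              move (m + suc (length s)) (length s) ∶
                y ∷ (toList zs ʳ++ (0 ∷ s)) ⟹ toList zs ʳ++ (y ∷ s)
  move-down s zs {y} =
    subst₂ (move (m + suc (length s)) (length s) ∶_⟹_)
      (cong (y ∷_) (ʳ++-++-assoc (toList zs) [] (0 ∷ s)))
      (ʳ++-++-assoc (toList zs) [] (y ∷ s))
      (⟹-≅ (move-top y a 0 s
              (trans (sym (length-args zs (0 ∷ s)))
                     (cong length (sym (ʳ++-++-assoc (toList zs) [] (0 ∷ s))))) refl)
           (λ j → trans (0∷-≅ (a ++ y + 0 ∷ s) j)
                        (cong (λ u → reg (a ++ u ∷ s) j) (+-identityʳ y))))
    where a = toList zs ʳ++ []

  comp-complete : ∀ {xs ρ ρ′} s ins → Args s ins xs → ρ ≗ reg s →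
                  ⟦ comp f gs ⟧ ins (length s) ⊢ ρ ⇒ ρ′ → ∃[ y ] comp f gs [ xs ]⇓ y
  comp-complete {ρ = ρ} s ins as ρ≗ (_；_ {ρ₁ = ρ₁} ps (_；_ {ρ₁ = ρ₂} p _))
    with completes cgs (0 ∷ s) ins (weaken-args 0 as) ρ≗0 ps
    where
    ρ≗0 : ρ ≗ reg (0 ∷ s)
    ρ≗0 j = trans (ρ≗ j) (sym (0∷-≅ s j))
  ... | zs , zs⇓
    with complete cf (toList zs ʳ++ (0 ∷ s)) _ (args-levels zs (0 ∷ s))
           (⟹-unique (sounds cgs (0 ∷ s) ins (weaken-args 0 as) zs⇓)
                     (λ j → trans (ρ≗ j) (sym (0∷-≅ s j))) ps)
           (subst (λ l → ⟦ f ⟧ (levels (suc (length s)) m) l ⊢ ρ₁ ⇒ ρ₂)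
                  (sym (length-args zs (0 ∷ s))) p)
  ... | y , y⇓ = y , comp⇓ zs⇓ y⇓

rec-correct : ∀ {n} {f : PR n} {g : PR (suc (suc n))} → Correct f → Correct g → Correct (rec f g)
rec-correct {n} {f} {g} cf cg = record { sound = rec-sound ; complete = rec-complete }
  where
  module _ (s : List ℕ) (ins xs : Vec ℕ n) (as : Args s ins xs) where
    d = length s

    body : Cmd
    body = ⟦ g ⟧ (2 + d ∷ d ∷ ins) (3 + d) ； clear d (4 + d) ； move (3 + d) d ； inc (2 + d)

    args-g : ∀ i c a → Args (i ∷ c ∷ a ∷ s) (2 + d ∷ d ∷ ins) (i ∷ a ∷ xs)
    args-g i c a = slot [] ∷ slot (i ∷ c ∷ []) ∷ weaken-args i (weaken-args c (weaken-args a as))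

    body-spec : ∀ {i c a a′} → g [ i ∷ a ∷ xs ]⇓ a′ →
                body ∶ i ∷ c ∷ a ∷ s ⟹ suc i ∷ c ∷ a′ ∷ s
    body-spec {i} {c} {a} {a′} g⇓ =
      sound cg (i ∷ c ∷ a ∷ s) _ (args-g i c a) g⇓ ⨾
      clear-mid (a′ ∷ i ∷ c ∷ []) a s refl refl ⨾
      ⟹-≅ (move-top a′ (i ∷ c ∷ []) 0 s refl refl)
          (λ j → trans (0∷-≅ (i ∷ c ∷ a′ + 0 ∷ s) j)
                       (cong (λ u → reg (i ∷ c ∷ u ∷ s) j) (+-identityʳ a′))) ⨾
      inc-mid [] i (c ∷ a′ ∷ s) refl

    -- A derivation for `rec` ends with the last iteration, a loop run begins with the first. So the
    -- rest of the run is an argument, and descending the derivation puts one iteration after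
    -- another in front of it.
    iterate : ∀ k {c y s′} → rec f g [ k ∷ xs ]⇓ y →
              loop (1 + d) body ∶ k ∷ c ∷ y ∷ s ⟹ s′ →
              ∃[ a ] f [ xs ]⇓ a × loop (1 + d) body ∶ 0 ∷ k + c ∷ a ∷ s ⟹ s′
    iterate zero (rec⇓0 f⇓) rest = _ , f⇓ , rest
    iterate (suc k) {c} {y} {s′} (rec⇓s {z = z} z⇓ g⇓) rest
      with iterate k z⇓ (loop-more (k ∷ []) c (z ∷ s) refl (body-spec g⇓) rest)
    ... | a , f⇓ , l = a , f⇓ , subst (λ u → loop (1 + d) body ∶ 0 ∷ u ∷ a ∷ s ⟹ s′) (+-suc k c) l

    -- The converse follows the loop forwards and builds the derivation up from index `i`, with `c`
    -- iterations to go.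
    unwind : ∀ c i {a ρ ρ′} → rec f g [ i ∷ xs ]⇓ a → ρ ≗ reg (i ∷ c ∷ a ∷ s) →
             loop (1 + d) body ⊢ ρ ⇒ ρ′ → ∃[ y ] rec f g [ c + i ∷ xs ]⇓ y
    unwind zero    i i⇓ _ _ = _ , i⇓
    unwind (suc c) i {a} {ρ} i⇓ ρ≗ (done e)
      with () ← trans (sym e) (trans (ρ≗ (suc d)) (reg-mid (i ∷ []) (suc c) (a ∷ s)))
    unwind (suc c) i {a} i⇓ ρ≗ (more e (p ； q) l)
      with trans (sym e) (trans (ρ≗ (suc d)) (reg-mid (i ∷ []) (suc c) (a ∷ s)))
    ... | refl
      with update-mid (i ∷ []) (suc c) (a ∷ s) ρ≗
    ... | ρ₁≗ with complete cg (i ∷ c ∷ a ∷ s) _ (args-g i c a) ρ₁≗ p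
    ... | a′ , g⇓ =
      subst (λ u → ∃[ y ] rec f g [ u ∷ xs ]⇓ y) (+-suc c i)
        (unwind c (suc i) (rec⇓s i⇓ g⇓) (⟹-unique (body-spec g⇓) ρ₁≗ (p ； q)) l)

  rec-sound : ∀ {xs y} s ins → Args s ins xs → rec f g [ xs ]⇓ y →
              ⟦ rec f g ⟧ ins (length s) ∶ s ⟹ y ∷ s
  rec-sound {k ∷ xs} {y} s (_ ∷ ins) (ak ∷ as) y⇓
    with iterate s ins xs as k {0} y⇓ (loop-done (k ∷ []) (y ∷ s) refl)
  ... | a , f⇓ , l =
    sound cf s ins as f⇓ ⨾
    ⟹-≅ (add-spec (weaken a ak))
         (λ j → trans (cong (λ u → reg (u ∷ a ∷ s) j) (sym (+-identityʳ k)))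
                      (sym (0∷-≅ (k + 0 ∷ a ∷ s) j))) ⨾
    l ⨾
    ⟹-≅ (clear-mid [] k (0 ∷ y ∷ s) refl refl)
        (λ j → trans (0∷-≅ (0 ∷ y ∷ s) j) (0∷-≅ (y ∷ s) j))

  rec-complete : ∀ {xs ρ ρ′} s ins → Args s ins xs → ρ ≗ reg s →
                 ⟦ rec f g ⟧ ins (length s) ⊢ ρ ⇒ ρ′ → ∃[ y ] rec f g [ xs ]⇓ y
  rec-complete {k ∷ xs} s (_ ∷ ins) (ak ∷ as) ρ≗ (p ； q ； l ； _)
    with complete cf s ins as ρ≗ p
  ... | a , f⇓ =
    subst (λ u → ∃[ y ] rec f g [ u ∷ xs ]⇓ y) (+-identityʳ k)
      (unwind s ins xs as k 0 (rec⇓0 f⇓)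
        (λ j → trans (⟹-unique (add-spec (weaken a ak)) (⟹-unique (sound cf s ins as f⇓) ρ≗ p) q j)
                     (sym (0∷-≅ (k ∷ a ∷ s) j)))
        l)

μ-correct : ∀ {n} {f : PR (suc n)} → Correct f → Correct (μ f)
μ-correct {n} {f} cf = record { sound = μ-sound ; complete = μ-complete }
  where
  module _ (s : List ℕ) (ins xs : Vec ℕ n) (as : Args s ins xs) where
    d = length s

    retry body : Cmd
    retry = clear (2 + d) (3 + d) ； inc (1 + d) ； inc d
    body  = ⟦ f ⟧ (d ∷ ins) (2 + d) ； loop (2 + d) retry

    args-f : ∀ i → Args (0 ∷ i ∷ s) (d ∷ ins) (i ∷ xs)
    args-f i = slot (0 ∷ []) ∷ weaken-args 0 (weaken-args i as)

    body-stop : ∀ {i} → f [ i ∷ xs ]⇓ 0 → body ∶ 0 ∷ i ∷ s ⟹ 0 ∷ i ∷ s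
    body-stop {i} f⇓ =
      sound cf (0 ∷ i ∷ s) _ (args-f i) f⇓ ⨾ ⟹-≅ (loop-done [] (0 ∷ i ∷ s) refl) (0∷-≅ (0 ∷ i ∷ s))

    body-retry : ∀ {i k} → f [ i ∷ xs ]⇓ suc k → body ∶ 0 ∷ i ∷ s ⟹ 1 ∷ suc i ∷ s
    body-retry {i} {k} f⇓ =
      sound cf (0 ∷ i ∷ s) _ (args-f i) f⇓ ⨾
      ⟹-≅ (loop-more [] k (0 ∷ i ∷ s) refl
             (clear-mid [] k (0 ∷ i ∷ s) refl refl ⨾ inc-mid (0 ∷ []) 0 (i ∷ s) refl ⨾
              inc-mid (0 ∷ 1 ∷ []) i s refl)
             (loop-done [] (1 ∷ suc i ∷ s) refl))
          (0∷-≅ (1 ∷ suc i ∷ s))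

    search : ∀ m i → f [ m + i ∷ xs ]⇓ 0 → (∀ {j} → j < m + i → ∃[ k ] f [ j ∷ xs ]⇓ suc k) →
             loop (1 + d) body ∶ 1 ∷ i ∷ s ⟹ 0 ∷ m + i ∷ s
    search zero    i f⇓0 _ = loop-more [] 0 (i ∷ s) refl (body-stop f⇓0) (loop-done [] (i ∷ s) refl)
    search (suc m) i f⇓0 f⇓s =
      loop-more [] 0 (i ∷ s) refl (body-retry (proj₂ (f⇓s (s≤s (m≤n+m i m)))))
        (subst (λ u → loop (1 + d) body ∶ 1 ∷ suc i ∷ s ⟹ 0 ∷ u ∷ s) (+-suc m i)
          (search m (suc i) (subst (λ u → f [ u ∷ xs ]⇓ 0) (sym (+-suc m i)) f⇓0)
            (λ {j} lt → f⇓s (subst (j <_) (+-suc m i) lt))))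

    -- The first hypothesis accumulates what `μ⇓` demands of the candidates already rejected.
    found : ∀ {i ρ ρ′} → (∀ {j} → j < i → ∃[ k ] f [ j ∷ xs ]⇓ suc k) →
            ρ ≗ reg (1 ∷ i ∷ s) → loop (1 + d) body ⊢ ρ ⇒ ρ′ → ∃[ y ] μ f [ xs ]⇓ y
    found {i} f⇓s ρ≗ (done e)
      with () ← trans (sym e) (trans (ρ≗ (suc d)) (reg-mid [] 1 (i ∷ s)))
    found {i} f⇓s ρ≗ (more e (p ； q) l)
      with trans (sym e) (trans (ρ≗ (suc d)) (reg-mid [] 1 (i ∷ s)))
    ... | refl with update-mid [] 1 (i ∷ s) ρ≗
    ... | ρ₁≗ with complete cf (0 ∷ i ∷ s) _ (args-f i) ρ₁≗ p
    ... | zero  , f⇓ = i , μ⇓ f⇓ f⇓s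
    ... | suc k , f⇓ = found f⇓s′ (⟹-unique (body-retry f⇓) ρ₁≗ (p ； q)) l
      where
      f⇓s′ : ∀ {j} → j < suc i → ∃[ k ] f [ j ∷ xs ]⇓ suc k
      f⇓s′ {j} lt with m≤n⇒m<n∨m≡n (s≤s⁻¹ lt)
      ... | inj₁ j<i  = f⇓s j<i
      ... | inj₂ refl = k , f⇓

  enter : ∀ s → inc (1 + length s) ∶ s ⟹ 1 ∷ 0 ∷ s
  enter s = ≅-⟹ (inc-mid [] 0 (0 ∷ s) refl)
                (λ j → sym (trans (0∷-≅ (0 ∷ s) j) (0∷-≅ s j)))

  μ-sound : ∀ {xs y} s ins → Args s ins xs → μ f [ xs ]⇓ y → ⟦ μ f ⟧ ins (length s) ∶ s ⟹ y ∷ s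
  μ-sound {xs} {y} s ins as (μ⇓ f⇓0 f⇓s) =
    enter s ⨾
    ⟹-≅ (subst (λ u → loop (1 + length s) (body s ins xs as) ∶ 1 ∷ 0 ∷ s ⟹ 0 ∷ u ∷ s) (+-identityʳ y)
           (search s ins xs as y 0 (subst (λ u → f [ u ∷ xs ]⇓ 0) (sym (+-identityʳ y)) f⇓0)
             (λ {j} lt → f⇓s (subst (j <_) (+-identityʳ y) lt))))
        (0∷-≅ (y ∷ s))

  μ-complete : ∀ {xs ρ ρ′} s ins → Args s ins xs → ρ ≗ reg s →
               ⟦ μ f ⟧ ins (length s) ⊢ ρ ⇒ ρ′ → ∃[ y ] μ f [ xs ]⇓ y
  μ-complete {xs} s ins as ρ≗ (p ； l) =
    found s ins xs as (λ ()) (⟹-unique (enter s) ρ≗ p) l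

mutual
  correct : ∀ {n} (f : PR n) → Correct f
  correct zero′       = zero-correct
  correct suc′        = suc-correct
  correct (proj i)    = proj-correct i
  correct (comp f gs) = comp-correct (correct f) (corrects gs)
  correct (rec f g)   = rec-correct (correct f) (correct g)
  correct (μ f)       = μ-correct (correct f)

  corrects : ∀ {m n} (gs : Vec (PR n) m) → Corrects gs
  corrects []       = []
  corrects (g ∷ gs) = correct g ∷ corrects gs

-- From counter programs to jump code

data Instr : Set where
  inc  : (r next : ℕ) → Instr
  test : (r nz z : ℕ) → Instr

size : Cmd → ℕ
size (inc r)    = 1
size (P ； Q)   = size P + size Q
size (loop r P) = suc (size P)

-- code P s e is placed at the addresses from s on and leaves to e.
code : Cmd → ℕ → ℕ → List Instr
code (inc r)    s e = inc r e ∷ []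
code (P ； Q)   s e = code P s (s + size P) ++ code Q (s + size P) e
code (loop r P) s e = test r (suc s) e ∷ code P (suc s) s

length-code : ∀ P s e → length (code P s e) ≡ size P
length-code (inc r)    s e = refl
length-code (P ； Q)   s e =
  trans (length-++ (code P s _)) (cong₂ _+_ (length-code P s _) (length-code Q _ e))
length-code (loop r P) s e = cong suc (length-code P (suc s) s)

module Machine (prog : List Instr) where

  Fetch : ℕ → Instr → Set
  Fetch ℓ i = Σ[ p ∈ Fin (length prog) ] toℕ p ≡ ℓ × List.lookup prog p ≡ i

  fetch-unique : ∀ {ℓ i j} → Fetch ℓ i → Fetch ℓ j → i ≡ j
  fetch-unique (p , refl , refl) (q , q≡p , refl) = cong (List.lookup prog) (toℕ-injective (sym q≡p))

  fetch-< : ∀ {ℓ i} → Fetch ℓ i → ℓ < length prog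
  fetch-< (p , refl , _) = toℕ<n p

  -- The first index only bounds the number of steps, since `halt` accepts any value. It is the
  -- measure for `halts-loop`.
  data Halts : ℕ → ℕ → Store → Set where
    halt    : ∀ {t ℓ ρ} → length prog ≤ ℓ → Halts t ℓ ρ
    inc     : ∀ {t ℓ ρ r ℓ′} → Fetch ℓ (inc r ℓ′) →
              Halts t ℓ′ (ρ [ r ↦ suc (ρ r) ]) → Halts (suc t) ℓ ρ
    zero    : ∀ {t ℓ ρ r nz z} → Fetch ℓ (test r nz z) → ρ r ≡ 0 →
              Halts t z ρ → Halts (suc t) ℓ ρ
    nonzero : ∀ {t ℓ ρ r nz z k} → Fetch ℓ (test r nz z) → ρ r ≡ suc k →
              Halts t nz (ρ [ r ↦ k ]) → Halts (suc t) ℓ ρ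

  CodeAt : ℕ → List Instr → Set
  CodeAt s []      = ⊤
  CodeAt s (i ∷ c) = Fetch s i × CodeAt (suc s) c

  codeAt-++ : ∀ c {s c′} → CodeAt s (c ++ c′) → CodeAt s c × CodeAt (s + length c) c′
  codeAt-++ []      {s} {c′} at = tt , subst (λ a → CodeAt a c′) (sym (+-identityʳ s)) at
  codeAt-++ (i ∷ c) {s} {c′} (f , at) with codeAt-++ c at
  ... | l , r = (f , l) , subst (λ a → CodeAt a c′) (sym (+-suc s (length c))) r

  codeAt-； : ∀ P Q {s e} → CodeAt s (code (P ； Q) s e) →
              CodeAt s (code P s (s + size P)) × CodeAt (s + size P) (code Q (s + size P) e)
  codeAt-； P Q {s} {e} at with codeAt-++ (code P s (s + size P)) at
  ... | l , r = l , subst (λ a → CodeAt (s + a) (code Q (s + size P) e)) (length-code P s _) r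

  ⇒-halts : ∀ P {s e ρ ρ′} → CodeAt s (code P s e) → P ⊢ ρ ⇒ ρ′ →
            ∃[ t ] Halts t e ρ′ → ∃[ t ] Halts t s ρ
  ⇒-halts (inc r) (f , _) inc (t , h) = suc t , inc f h
  ⇒-halts (P ； Q) at (p ； q) h with codeAt-； P Q at
  ... | atP , atQ = ⇒-halts P atP p (⇒-halts Q atQ q h)
  ⇒-halts (loop r P) (f , _) (done e) (t , h) = suc t , zero f e h
  ⇒-halts (loop r P) ca@(f , atP) (more e p q) h
    with ⇒-halts P atP p (⇒-halts (loop r P) ca q h)
  ... | t , h′ = suc t , nonzero f e h′

  Exits : Cmd → ℕ → ℕ → Store → Set
  Exits P e t ρ = ∃[ ρ′ ] ∃[ t′ ] P ⊢ ρ ⇒ ρ′ × t′ ≤ t × Halts t′ e ρ′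

  mutual
    halts-⇒ : ∀ P {s e ρ t} → CodeAt s (code P s e) → Halts t s ρ → Exits P e t ρ
    halts-⇒ P@(inc _) (f , _) (halt le) = contradiction le (<⇒≱ (fetch-< f))
    halts-⇒ (inc r) (f , _) (inc f′ h) with fetch-unique f f′
    ... | refl = _ , _ , inc , n≤1+n _ , h
    halts-⇒ (inc r) (f , _) (zero f′ _ _) with () ← fetch-unique f f′
    halts-⇒ (inc r) (f , _) (nonzero f′ _ _) with () ← fetch-unique f f′
    halts-⇒ (P ； Q) at h with codeAt-； P Q at
    ... | atP , atQ with halts-⇒ P atP h
    ... | ρ₁ , t₁ , p , t₁≤ , h₁ with halts-⇒ Q atQ h₁
    ... | ρ₂ , t₂ , q , t₂≤ , h₂ = ρ₂ , t₂ , p ； q , ≤-trans t₂≤ t₁≤ , h₂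
    halts-⇒ (loop r P) at h = halts-loop _ ≤-refl at h

    -- The run that remains after the loop body is not a subterm of the given run but has a smaller
    -- bound, so the recursion is on `n`.
    halts-loop : ∀ {r P s e ρ t} n → t ≤ n → CodeAt s (code (loop r P) s e) → Halts t s ρ →
                 Exits (loop r P) e t ρ
    halts-loop n t≤n (f , _) (halt le) = contradiction le (<⇒≱ (fetch-< f))
    halts-loop n t≤n (f , _) (inc f′ _) with () ← fetch-unique f f′
    halts-loop n t≤n (f , _) (zero f′ e h) with fetch-unique f f′
    ... | refl = _ , _ , done e , n≤1+n _ , h
    halts-loop {P = P} (suc n) (s≤s t≤n) ca@(f , atP) (nonzero f′ e h) with fetch-unique f f′
    ... | refl with halts-⇒ P atP h
    ... | ρ₁ , t₁ , p , t₁≤ , h₁ with halts-loop n (≤-trans t₁≤ t≤n) ca h₁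
    ... | ρ₂ , t₂ , q , t₂≤ , h₂ =
      ρ₂ , t₂ , more e p q , m≤n⇒m≤1+n (≤-trans t₂≤ t₁≤) , h₂

codeAt-self : ∀ c → Machine.CodeAt c 0 c
codeAt-self c = go [] c
  where
  fetch-mid : ∀ pre i c → Machine.Fetch (pre ++ i ∷ c) (length pre) i
  fetch-mid []        i c = Fin.zero , refl , refl
  fetch-mid (_ ∷ pre) i c with fetch-mid pre i c
  ... | p , p≡ , l≡ = Fin.suc p , cong suc p≡ , l≡

  go : ∀ pre c → Machine.CodeAt (pre ++ c) (length pre) c
  go pre []      = tt
  go pre (i ∷ c) = fetch-mid pre i c ,
    subst₂ (λ l d → Machine.CodeAt d l c) (trans (length-++ pre) (+-comm (length pre) 1))
      (++-assoc pre (i ∷ []) c) (go (pre ++ i ∷ []) c)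

-- The exit `size P` is the first address outside the code, so leaving the command means halting.
program : Cmd → List Instr
program P = code P 0 (size P)

program-correct : ∀ P {ρ} → (∃[ ρ′ ] P ⊢ ρ ⇒ ρ′) ⇔ (∃[ t ] Machine.Halts (program P) t 0 ρ)
program-correct P = mk⇔
  (λ { (_ , p) → ⇒-halts P (codeAt-self (program P)) p
                   (0 , halt (≤-reflexive (length-code P 0 (size P)))) })
  (λ { (_ , h) → let ρ′ , _ , p , _ = halts-⇒ P (codeAt-self (program P)) h in ρ′ , p })
  where open Machine (program P)

-- The gadgets and their connections

kit : Vec Gadget 3
kit = increment ∷ register ∷ updsds ∷ []

-- The position is a number, not an element of `Fin`, so it is literally the same after the list is
-- extended at its end.
data Position {A : Set} (x : A) : List A → ℕ → Set where
  here  : ∀ {xs} → Position x (x ∷ xs) 0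
  there : ∀ {y xs k} → Position x xs k → Position x (y ∷ xs) (suc k)

module _ {A : Set} where

  position-unique : ∀ {x y : A} {xs k} → Position x xs k → Position y xs k → x ≡ y
  position-unique here      here      = refl
  position-unique (there p) (there q) = position-unique p q

  position-++ˡ : ∀ {x : A} {xs ys k} → Position x xs k → Position x (xs ++ ys) k
  position-++ˡ here      = here
  position-++ˡ (there p) = there (position-++ˡ p)

  position-++ʳ : ∀ {x : A} xs {ys k} → Position x ys k → Position x (xs ++ ys) (length xs + k)
  position-++ʳ []       p = p
  position-++ʳ (_ ∷ xs) p = there (position-++ʳ xs p)

  position-tabulate : ∀ {n} (f : Fin n → A) i → Position (f i) (List.tabulate f) (toℕ i)
  position-tabulate f 0F          = here
  position-tabulate f (Fin.suc i) = there (position-tabulate (f ∘ Fin.suc) i)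

  index : ∀ {x : A} {xs k} → Position x xs k → Fin (length xs)
  index here      = 0F
  index (there p) = Fin.suc (index p)

  toℕ-index : ∀ {x : A} {xs k} (p : Position x xs k) → toℕ (index p) ≡ k
  toℕ-index here      = refl
  toℕ-index (there p) = cong suc (toℕ-index p)

  lookup-index : ∀ {x : A} {xs k} (p : Position x xs k) → List.lookup xs (index p) ≡ x
  lookup-index here      = refl
  lookup-index (there p) = lookup-index p

position-map : ∀ {A B : Set} (f : A → B) {x xs k} → Position x xs k → Position (f x) (map f xs) k
position-map f here      = here
position-map f (there p) = there (position-map f p)

-- Total on both kinds of instruction, so the wiring needs no case distinction; `nzOf` is also the
-- successor of an `inc`.
regOf nzOf zOf : Instr → ℕ
regOf (inc r _)    = r
regOf (test r _ _) = r
nzOf (inc _ ℓ)     = ℓ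
nzOf (test _ nz _) = nz
zOf (inc _ ℓ)      = ℓ
zOf (test _ _ z)   = z

bound : List Instr → ℕ
bound = foldr (λ i b → regOf i ⊔ b) 0

regOf≤bound : ∀ prog p → regOf (List.lookup prog p) ≤ bound prog
regOf≤bound (i ∷ prog) 0F          = m≤m⊔n _ _
regOf≤bound (i ∷ prog) (Fin.suc p) = ≤-trans (regOf≤bound prog p) (m≤n⊔m (regOf i) _)

module Layout (prog : List Instr) where

  -- `R` is positive for every program, so `cell 0F`, which receives the input, always exists.
  N R : ℕ
  N = length prog
  R = suc (bound prog)

  instr : Fin N → Instr
  instr = List.lookup prog

  regAt : Fin N → Fin R
  regAt p = fromℕ< (s≤s (regOf≤bound prog p))

  toℕ-regAt : ∀ p → toℕ (regAt p) ≡ regOf (instr p)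
  toℕ-regAt p = toℕ-fromℕ< (s≤s (regOf≤bound prog p))

  -- The increment gadget 0 releases the robot that executes the program, and
  -- the increment gadget 1 + p and the UPDSDS gadget p belong to instruction p.
  data Idx₀ : Set where
    cell : Fin R → Idx₀
    flag : Fin N → Idx₀
    feed : Fin (suc N) → Idx₀

  kind₀ : Idx₀ → Fin 3
  kind₀ (cell _) = 1F
  kind₀ (flag _) = 2F
  kind₀ (feed _) = 0F

  init₀ : (g : Idx₀) → Fin (#states (Vec.lookup kit (kind₀ g)))
  init₀ (cell _)              = 0F
  init₀ (flag _)              = UPDSDS.down
  init₀ (feed 0F)             = 1F
  init₀ (feed (Fin.suc _))    = 0F

  data Loc₀ : Set where
    sp : Fin (suc N) → Loc₀
    at : (g : Idx₀) → Fin (#locations (Vec.lookup kit (kind₀ g))) → Loc₀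

  -- Only leaving the program leads to `target₀`. Once the program robot has passed `feed 0F`, this
  -- gadget stays shut until the target is hit, so robots sent to its door `waste` are gone for
  -- good.
  target₀ waste : Loc₀
  target₀ = at (feed 0F) Increment.p₂
  waste   = at (feed 0F) Increment.e

  start : Instr → Fin N → Loc₀
  start (inc _ _)    p = at (feed (Fin.suc p)) Increment.p₁
  start (test _ _ _) p = at (flag p) UPDSDS.t-in

  entry : ℕ → Loc₀
  entry ℓ with ℓ <? N
  ... | yes ℓ<N = start (instr (fromℕ< ℓ<N)) (fromℕ< ℓ<N)
  ... | no  _   = target₀

  -- `x` is the input of one of the two switches: the chain of first switches carries the answer
  -- nonzero, that of second switches the answer zero.
  chain : Fin 8 → ℕ → Loc₀
  chain x ℓ with ℓ <? N
  ... | yes ℓ<N = at (flag (fromℕ< ℓ<N)) x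
  ... | no  _   = waste

  incExits : Fin (suc N) → Vec (Maybe Loc₀) 10
  incExits 0F =
    nothing ∷ nothing ∷ nothing ∷ nothing ∷ nothing ∷ nothing ∷ nothing ∷
    just (entry 0) ∷ nothing ∷ nothing ∷ []
  incExits (Fin.suc p) =
    nothing ∷ nothing ∷ nothing ∷ just (entry (nzOf (instr p))) ∷ nothing ∷ nothing ∷ nothing ∷
    just (at (cell (regAt p)) Register.e) ∷ nothing ∷ nothing ∷ []

  -- From `q-J` the program robot goes on to the response branch of the same register. If a waiting
  -- robot has left by `f-J`, the register is back in its original state, so `s-top` means nonzero
  -- and `s-bot` means zero.
  regExits : Fin R → Vec (Maybe Loc₀) 10
  regExits k =
    nothing ∷ nothing ∷ nothing ∷ just (at (cell k) Register.r) ∷ nothing ∷ nothing ∷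
    just waste ∷ nothing ∷ just (chain UPDSDS.x₁ 0) ∷ just (chain UPDSDS.x₂ 0) ∷ []

  updExits : Fin N → Vec (Maybe Loc₀) 8
  updExits p =
    nothing ∷ just (at (cell (regAt p)) Register.p-J) ∷
    nothing ∷ just (entry (nzOf (instr p))) ∷ just (chain UPDSDS.x₁ (suc (toℕ p))) ∷
    nothing ∷ just (entry (zOf (instr p))) ∷ just (chain UPDSDS.x₂ (suc (toℕ p))) ∷ []

  exit₀ : Loc₀ → Maybe Loc₀
  exit₀ (sp i)         = just (at (feed i) Increment.e)
  exit₀ (at (cell k) a) = Vec.lookup (regExits k) a
  exit₀ (at (flag p) a) = Vec.lookup (updExits p) a
  exit₀ (at (feed i) a) = Vec.lookup (incExits i) a

  exit₀-entry : ∀ ℓ → exit₀ (entry ℓ) ≡ nothing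
  exit₀-entry ℓ with ℓ <? N
  ... | no  _   = refl
  ... | yes ℓ<N with instr (fromℕ< ℓ<N)
  ...   | inc _ _    = refl
  ...   | test _ _ _ = refl

  exit₀-chain-x₁ : ∀ ℓ → exit₀ (chain UPDSDS.x₁ ℓ) ≡ nothing
  exit₀-chain-x₁ ℓ with ℓ <? N
  ... | yes _ = refl
  ... | no  _ = refl

  exit₀-chain-x₂ : ∀ ℓ → exit₀ (chain UPDSDS.x₂ ℓ) ≡ nothing
  exit₀-chain-x₂ ℓ with ℓ <? N
  ... | yes _ = refl
  ... | no  _ = refl

  Entrance : Maybe Loc₀ → Set
  Entrance nothing  = ⊤
  Entrance (just b) = exit₀ b ≡ nothing

  exit₀-entrance : ∀ a → Entrance (exit₀ a)
  exit₀-entrance (sp 0F)          = refl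
  exit₀-entrance (sp (Fin.suc _)) = refl
  exit₀-entrance (at (cell k) a)   = VecAllₚ.lookup⁺ entrances a
    where
    entrances : VecAll.All Entrance (regExits k)
    entrances = tt ∷ tt ∷ tt ∷ refl ∷ tt ∷ tt ∷ refl ∷ tt ∷ exit₀-chain-x₁ 0 ∷ exit₀-chain-x₂ 0 ∷ []
  exit₀-entrance (at (flag p) a)   = VecAllₚ.lookup⁺ entrances a
    where
    entrances : VecAll.All Entrance (updExits p)
    entrances = tt ∷ refl ∷ tt ∷ exit₀-entry _ ∷ exit₀-chain-x₁ _ ∷ tt ∷ exit₀-entry _ ∷ exit₀-chain-x₂ _ ∷ []
  exit₀-entrance (at (feed 0F) a) = VecAllₚ.lookup⁺ entrances a
    where
    entrances : VecAll.All Entrance (incExits 0F)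
    entrances = tt ∷ tt ∷ tt ∷ tt ∷ tt ∷ tt ∷ tt ∷ exit₀-entry 0 ∷ tt ∷ tt ∷ []
  exit₀-entrance (at (feed (Fin.suc p)) a) = VecAllₚ.lookup⁺ entrances a
    where
    entrances : VecAll.All Entrance (incExits (Fin.suc p))
    entrances = tt ∷ tt ∷ tt ∷ exit₀-entry _ ∷ tt ∷ tt ∷ tt ∷ refl ∷ tt ∷ tt ∷ []

  idxs₀ : List Idx₀
  idxs₀ = map cell (allFin R) ++ map flag (allFin N) ++ map feed (allFin (suc N))

  place₀ : ∀ g → ∃[ k ] Position g idxs₀ k
  place₀ (cell k) = _ , position-++ˡ (position-map cell (position-tabulate id k))
  place₀ (flag p) = _ , position-++ʳ (map cell (allFin R))
                         (position-++ˡ (position-map flag (position-tabulate id p)))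
  place₀ (feed i) = _ , position-++ʳ (map cell (allFin R)) (position-++ʳ (map flag (allFin N))
                         (position-map feed (position-tabulate id i)))

  incLocs regLocs updLocs locs₀ : List Loc₀
  incLocs = cartesianProductWith (λ i → at (feed i)) (allFin (suc N)) (allFin 10)
  regLocs = cartesianProductWith (λ k → at (cell k)) (allFin R) (allFin 10)
  updLocs = cartesianProductWith (λ p → at (flag p)) (allFin N) (allFin 8)
  locs₀   = map sp (allFin (suc N)) ++ incLocs ++ regLocs ++ updLocs

  ∈-locs₀ : ∀ a → a ∈ locs₀
  ∈-locs₀ (sp i)         = ∈-++⁺ˡ (∈-map⁺ sp (∈-allFin i))
  ∈-locs₀ (at (feed i) a) = ∈-++⁺ʳ (map sp (allFin (suc N))) (∈-++⁺ˡ
    (∈-cartesianProductWith⁺ (λ i → at (feed i)) (∈-allFin i) (∈-allFin a)))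
  ∈-locs₀ (at (cell k) a) = ∈-++⁺ʳ (map sp (allFin (suc N))) (∈-++⁺ʳ incLocs (∈-++⁺ˡ
    (∈-cartesianProductWith⁺ (λ k → at (cell k)) (∈-allFin k) (∈-allFin a))))
  ∈-locs₀ (at (flag p) a) = ∈-++⁺ʳ (map sp (allFin (suc N))) (∈-++⁺ʳ incLocs (∈-++⁺ʳ regLocs
    (∈-cartesianProductWith⁺ (λ p → at (flag p)) (∈-allFin p) (∈-allFin a))))

  unique-locs₀ : Unique locs₀
  unique-locs₀ =
    Unique.++⁺ (Unique.map⁺ (λ { refl → refl }) (Unique.allFin⁺ (suc N)))
      (Unique.++⁺ (product (λ i → at (feed i)) (λ { refl → refl , refl }))
        (Unique.++⁺ (product (λ k → at (cell k)) (λ { refl → refl , refl }))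
                    (product (λ p → at (flag p)) (λ { refl → refl , refl })) reg#upd)
        inc#)
      sp#
    where
    product : ∀ {m k} (f : Fin m → Fin k → Loc₀) → (∀ {w x y z} → f w y ≡ f x z → w ≡ x × y ≡ z) →
              Unique (cartesianProductWith f (allFin m) (allFin k))
    product f inj = Unique.cartesianProductWith⁺ f inj (Unique.allFin⁺ _) (Unique.allFin⁺ _)

    from-inc : ∀ {v} → v ∈ incLocs → ∃[ i ] ∃[ a ] v ≡ at (feed i) a
    from-inc v∈ with ∈-cartesianProductWith⁻ (λ i → at (feed i)) (allFin (suc N)) (allFin 10) v∈
    ... | i , a , _ , _ , eq = i , a , eq
    from-reg : ∀ {v} → v ∈ regLocs → ∃[ i ] ∃[ a ] v ≡ at (cell i) a
    from-reg v∈ with ∈-cartesianProductWith⁻ (λ i → at (cell i)) (allFin R) (allFin 10) v∈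
    ... | i , a , _ , _ , eq = i , a , eq
    from-upd : ∀ {v} → v ∈ updLocs → ∃[ i ] ∃[ a ] v ≡ at (flag i) a
    from-upd v∈ with ∈-cartesianProductWith⁻ (λ i → at (flag i)) (allFin N) (allFin 8) v∈
    ... | i , a , _ , _ , eq = i , a , eq

    reg#upd : ∀ {v} → ¬ (v ∈ regLocs × v ∈ updLocs)
    reg#upd (v∈ , v∈′) with from-reg v∈ | from-upd v∈′
    ... | _ , _ , refl | _ , _ , ()

    inc# : ∀ {v} → ¬ (v ∈ incLocs × v ∈ regLocs ++ updLocs)
    inc# (v∈ , v∈′) with from-inc v∈ | ∈-++⁻ regLocs v∈′
    ... | _ , _ , refl | inj₁ v∈ʳ with from-reg v∈ʳ
    ...   | _ , _ , ()
    inc# (v∈ , v∈′) | _ , _ , refl | inj₂ v∈ᵘ with from-upd v∈ᵘ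
    ...   | _ , _ , ()

    sp# : ∀ {v} → ¬ (v ∈ map sp (allFin (suc N)) × v ∈ incLocs ++ regLocs ++ updLocs)
    sp# (v∈ , v∈′) with ∈-map⁻ sp v∈ | ∈-++⁻ incLocs v∈′
    ... | _ , _ , refl | inj₁ v∈ⁱ with from-inc v∈ⁱ
    ...   | _ , _ , ()
    sp# (v∈ , v∈′) | _ , _ , refl | inj₂ v∈″ with ∈-++⁻ regLocs v∈″
    ...   | inj₁ v∈ʳ with from-reg v∈ʳ
    ...     | _ , _ , ()
    sp# (v∈ , v∈′) | _ , _ , refl | inj₂ v∈″ | inj₂ v∈ᵘ with from-upd v∈ᵘ
    ...     | _ , _ , ()

  isExit₀? : ∀ a → Dec (T (is-just (exit₀ a)))
  isExit₀? a = T? (is-just (exit₀ a))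

  exits₀ : List Loc₀
  exits₀ = filter isExit₀? locs₀

-- Descending, so that the list for n + 1 extends the list for n at its head.
allFin↓ : ∀ n → List (Fin n)
allFin↓ zero    = []
allFin↓ (suc n) = fromℕ n ∷ map inject₁ (allFin↓ n)

map-toℕ-allFin↓ : ∀ n → map toℕ (allFin↓ n) ≡ downFrom n
map-toℕ-allFin↓ zero    = refl
map-toℕ-allFin↓ (suc n) = cong₂ _∷_ (toℕ-fromℕ n)
  (trans (sym (map-∘ (allFin↓ n))) (trans (map-cong toℕ-inject₁ (allFin↓ n)) (map-toℕ-allFin↓ n)))

∈-allFin↓ : ∀ {n} (i : Fin n) → i ∈ allFin↓ n
∈-allFin↓ {n} i with ∈-map⁻ toℕ (subst (toℕ i ∈_) (sym (map-toℕ-allFin↓ n)) (∈-downFrom⁺ (toℕ<n i)))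
... | j , j∈ , eq = subst (_∈ allFin↓ n) (toℕ-injective (sym eq)) j∈

unique-allFin↓ : ∀ n → Unique (allFin↓ n)
unique-allFin↓ n = Unique.map⁻ {f = toℕ} (subst Unique (sym (map-toℕ-allFin↓ n)) (Unique.downFrom⁺ n))

LocAt StAt : Copy kit → Set
LocAt c = Fin (#locations (Vec.lookup kit (proj₁ c)))
StAt  c = Fin (#states (Vec.lookup kit (proj₁ c)))

-- State updates and turns in an arbitrary system

module _ {k} {Γ : Vec Gadget k} (S : System Γ) where
  open System S

  set-same : ∀ i s σ → set i s σ i ≡ s
  set-same i s σ with i Finₚ.≟ i
  ... | yes refl = refl
  ... | no ≢     = contradiction refl ≢

  set-other : ∀ {i j} s σ → i ≢ j → set i s σ j ≡ σ j
  set-other {i} {j} s σ i≢j with i Finₚ.≟ j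
  ... | yes i≡j = contradiction i≡j i≢j
  ... | no _    = refl

  traverse-nothing : ∀ {σ i a} → transition (gadgetAt Γ gadgets i) (σ i) a ≡ nothing →
                     traverse σ (inj₂ (i , a)) ≡ (σ , inj₂ (i , a))
  traverse-nothing eq rewrite eq = refl

  traverse-just : ∀ {σ i a s b} → transition (gadgetAt Γ gadgets i) (σ i) a ≡ just (s , b) →
                  traverse σ (inj₂ (i , a)) ≡ (set i s σ , inj₂ (i , b))
  traverse-just eq rewrite eq = refl

  turns-∷ : ∀ {σ a as σ₁ a′ σ₂ as′} → turn σ a ≡ (σ₁ , a′) → turns σ₁ as ≡ (σ₂ , as′) →
            turns σ (a ∷ as) ≡ (σ₂ , a′ ∷ as′)
  turns-∷ e es rewrite e | es = refl

  turns-++ : ∀ {σ} as {bs σ₁ as′ σ₂ bs′} → turns σ as ≡ (σ₁ , as′) → turns σ₁ bs ≡ (σ₂ , bs′) →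
             turns σ (as ++ bs) ≡ (σ₂ , as′ ++ bs′)
  turns-++ []       refl es = es
  turns-++ {σ} (a ∷ as) {bs} {σ₁} e es
    with turn σ a | e
  ... | σ′ , a′ | e with turns σ′ as in eq | e
  ... | _ | refl rewrite turns-++ as {bs} eq es = refl

  round-turns : ∀ {σ as σ′ as′} → turns σ as ≡ (σ′ , as′) →
                round (σ , as) ≡ (σ′ , as′ ++ map inj₁ (allFin #spawners))
  round-turns e rewrite e = refl

tabulate-+ : ∀ {A : Set} m {n} (f : Fin (m + n) → A) →
             tabulate f ≡ tabulate (f ∘ (_↑ˡ n)) ++ tabulate (f ∘ (m ↑ʳ_))
tabulate-+ zero    f = refl
tabulate-+ (suc m) f = cong (f 0F ∷_) (tabulate-+ m (f ∘ Fin.suc))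

module Wiring (prog : List Instr) (n : ℕ) where

  open Layout prog

  -- The gates load the input: in the second round, each of them lets a single
  -- robot pass to cell 0.
  data Idx : Set where
    base : Idx₀ → Idx
    gate : Fin n → Idx

  kind : Idx → Fin 3
  kind (base g) = kind₀ g
  kind (gate _) = 0F

  St : Idx → Set
  St g = Fin (#states (Vec.lookup kit (kind g)))

  init : (g : Idx) → St g
  init (base g) = init₀ g
  init (gate _) = 1F

  data ALoc : Set where
    sp  : Fin (suc N) → ALoc
    gsp : Fin n → ALoc
    at  : (g : Idx) → Fin (#locations (Vec.lookup kit (kind g))) → ALoc

  embed : Loc₀ → ALoc
  embed (sp i)   = sp i
  embed (at g a) = at (base g) a

  embed-injective : ∀ {a b} → embed a ≡ embed b → a ≡ b
  embed-injective {sp i}   {sp i}   refl = refl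
  embed-injective {at g a} {at g a} refl = refl

  gateExits : Vec (Maybe ALoc) 10
  gateExits =
    nothing ∷ nothing ∷ nothing ∷ nothing ∷ nothing ∷ nothing ∷ nothing ∷
    just (at (base (cell 0F)) Register.e) ∷ nothing ∷ nothing ∷ []

  exit : ALoc → Maybe ALoc
  exit (sp i)          = Maybe.map embed (exit₀ (sp i))
  exit (gsp j)         = just (at (gate j) Increment.e)
  exit (at (base g) a) = Maybe.map embed (exit₀ (at g a))
  exit (at (gate j) a) = Vec.lookup gateExits a

  exit-embed : ∀ a → exit (embed a) ≡ Maybe.map embed (exit₀ a)
  exit-embed (sp i)   = refl
  exit-embed (at g a) = refl

  exit-entrance₀ : ∀ a {b} → Maybe.map embed (exit₀ a) ≡ just b → exit b ≡ nothing
  exit-entrance₀ a eq with exit₀ a | exit₀-entrance a | eq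
  ... | just b | e | refl = trans (exit-embed b) (cong (Maybe.map embed) e)

  exit-entrance : ∀ a {b} → exit a ≡ just b → exit b ≡ nothing
  exit-entrance (sp i)            eq   = exit-entrance₀ (sp i) eq
  exit-entrance (gsp j)           refl = refl
  exit-entrance (at (base g) a)   eq   = exit-entrance₀ (at g a) eq
  exit-entrance (at (gate j) 7F)  refl = refl
  exit-entrance (at (gate j) 0F)  ()
  exit-entrance (at (gate j) 1F)  ()
  exit-entrance (at (gate j) 2F)  ()
  exit-entrance (at (gate j) 3F)  ()
  exit-entrance (at (gate j) 4F)  ()
  exit-entrance (at (gate j) 5F)  ()
  exit-entrance (at (gate j) 6F)  ()
  exit-entrance (at (gate j) 8F)  ()
  exit-entrance (at (gate j) 9F)  ()

  next : ALoc → ALoc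
  next a = fromMaybe a (exit a)

  exit-next : ∀ a → exit (next a) ≡ nothing
  exit-next a with exit a in eq
  ... | just b  = exit-entrance a eq
  ... | nothing = eq

  gadget : Idx → Gadget
  gadget g = Vec.lookup kit (kind g)

  -- In a `System` the types of states and locations depend on a list lookup, which forces
  -- transports. These equations are all that the dynamics uses, so no transport appears there.
  record Realisation (S : System kit) : Set where
    open System S
    field
      _≟ᴵ_          : DecidableEquality Idx
      ι           : ALoc → Location
      ι-injective : ∀ {a b} → ι a ≡ ι b → a ≡ b
      follow-ι    : ∀ a → follow (ι a) ≡ ι (next a)
      get         : States → (g : Idx) → St g
      put         : (g : Idx) → St g → States → States
      get-put-same  : ∀ g s σ → get (put g s σ) g ≡ s
      get-put-other : ∀ {g h} s σ → g ≢ h → get (put g s σ) h ≡ get σ h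
      get-initial   : ∀ g → get initial g ≡ init g
      turn-stuck    : ∀ {σ a g l} → next a ≡ at g l → transition (gadget g) (get σ g) l ≡ nothing →
                      turn σ (ι a) ≡ (σ , ι (at g l))
      turn-traverse : ∀ {σ a g l s b} → next a ≡ at g l → transition (gadget g) (get σ g) l ≡ just (s , b) →
                      turn σ (ι a) ≡ (put g s σ , ι (at g b))
      spawners      : map inj₁ (allFin #spawners) ≡ map (ι ∘ sp) (allFin (suc N)) ++ map (ι ∘ gsp) (allFin n)

-- The concrete system and its well-formedness

module Network (prog : List Instr) (n : ℕ) where

  open Layout prog
  open Wiring prog n

  idxs : List Idx
  idxs = map base idxs₀ ++ map gate (allFin n)

  place : ∀ g → ∃[ k ] Position g idxs k
  place (base g) = _ , position-++ˡ (position-map base (proj₂ (place₀ g)))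
  place (gate j) = _ , position-++ʳ (map base idxs₀) (position-map gate (position-tabulate id j))

  copy : Idx → Copy kit
  copy g = kind g , init g

  gadgets : List (Copy kit)
  gadgets = map copy idxs

  idx : Idx → Fin (length gadgets)
  idx g = index (position-map copy (proj₂ (place g)))

  lookup-idx : ∀ g → List.lookup gadgets (idx g) ≡ copy g
  lookup-idx g = lookup-index (position-map copy (proj₂ (place g)))

  toℕ-idx : ∀ g → toℕ (idx g) ≡ proj₁ (place g)
  toℕ-idx g = toℕ-index (position-map copy (proj₂ (place g)))

  idx-injective : ∀ {g h} → idx g ≡ idx h → g ≡ h
  idx-injective {g} {h} eq = position-unique (proj₂ (place g))
    (subst (Position h idxs) (trans (sym (toℕ-idx h)) (trans (cong toℕ (sym eq)) (toℕ-idx g)))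
           (proj₂ (place h)))

  ι : ALoc → Loc kit gadgets (suc N + n)
  ι (sp i)   = inj₁ (i ↑ˡ n)
  ι (gsp j)  = inj₁ (suc N ↑ʳ j)
  ι (at g a) = inj₂ (idx g , subst LocAt (sym (lookup-idx g)) a)

  ι-injective : ∀ {a b} → ι a ≡ ι b → a ≡ b
  ι-injective {sp i}  {sp j}  eq = cong sp (Finₚ.↑ˡ-injective n i j (inj₁-injective eq))
  ι-injective {gsp i} {gsp j} eq = cong gsp (Finₚ.↑ʳ-injective (suc N) i j (inj₁-injective eq))
  ι-injective {sp i}  {gsp j} eq
    with () ← trans (sym (Finₚ.splitAt-↑ˡ (suc N) i n))
                (trans (cong (splitAt (suc N)) (inj₁-injective eq)) (Finₚ.splitAt-↑ʳ (suc N) n j))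
  ι-injective {gsp j} {sp i} eq
    with () ← trans (sym (Finₚ.splitAt-↑ˡ (suc N) i n))
                (trans (cong (splitAt (suc N)) (inj₁-injective (sym eq))) (Finₚ.splitAt-↑ʳ (suc N) n j))
  ι-injective {at g a} {at h b} eq with idx-injective {g} {h} (cong proj₁ (inj₂-injective eq))
  ... | refl = cong (at g) (subst-injective (sym (lookup-idx g)) (proj₂-injective (inj₂-injective eq)))
    where
    proj₂-injective : ∀ {A : Set} {B : A → Set} {a : A} {x y : B a} →
                      _≡_ {A = Σ[ a ∈ A ] B a} (a , x) (a , y) → x ≡ y
    proj₂-injective refl = refl

  gateExit : Fin n → Bool → ALoc
  gateExit j true  = gsp j
  gateExit j false = at (gate j) Increment.f₁

  gateExit-injective : ∀ {i j b c} → gateExit i b ≡ gateExit j c → i ≡ j × b ≡ c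
  gateExit-injective {b = true}  {true}  refl = refl , refl
  gateExit-injective {b = false} {false} refl = refl , refl
  gateExit-injective {b = true}  {false} ()
  gateExit-injective {b = false} {true}  ()

  exits : List ALoc
  exits = cartesianProductWith gateExit (allFin↓ n) (true ∷ false ∷ []) ++ map embed exits₀

  unique-exits : Unique exits
  unique-exits = Unique.++⁺
    (Unique.cartesianProductWith⁺ gateExit
      gateExit-injective
      (unique-allFin↓ n) (((λ ()) ∷ []) ∷ [] ∷ []))
    (Unique.map⁺ embed-injective (Unique.filter⁺ isExit₀? unique-locs₀))
    gate#base
    where
    gate#base : ∀ {v} →
      ¬ (v ∈ cartesianProductWith gateExit (allFin↓ n) (true ∷ false ∷ []) × v ∈ map embed exits₀)
    gate#base (v∈ , v∈′)
      with ∈-cartesianProductWith⁻ gateExit (allFin↓ n) (true ∷ false ∷ []) v∈ | ∈-map⁻ embed v∈′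
    ... | _ , true  , _ , _ , refl | sp _   , _ , ()
    ... | _ , true  , _ , _ , refl | at _ _ , _ , ()
    ... | _ , false , _ , _ , refl | sp _   , _ , ()
    ... | _ , false , _ , _ , refl | at _ _ , _ , ()

  ∈-exits₀ : ∀ a {b} → exit (embed a) ≡ just b → embed a ∈ exits
  ∈-exits₀ a eq = ∈-++⁺ʳ _ (∈-map⁺ embed (∈-filter⁺ isExit₀? (∈-locs₀ a)
    (isExit (trans (sym (exit-embed a)) eq))))
    where
    isExit : ∀ {m : Maybe Loc₀} {b} → Maybe.map embed m ≡ just b → T (is-just m)
    isExit {just _} _ = _

  ∈-exits : ∀ a {b} → exit a ≡ just b → a ∈ exits
  ∈-exits (sp i)           eq = ∈-exits₀ (sp i) eq
  ∈-exits (at (base g) a)  eq = ∈-exits₀ (at g a) eq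
  ∈-exits (gsp j)          eq =
    ∈-++⁺ˡ (∈-cartesianProductWith⁺ gateExit {b = true} (∈-allFin↓ j) (here refl))
  ∈-exits (at (gate j) 7F) eq =
    ∈-++⁺ˡ (∈-cartesianProductWith⁺ gateExit {b = false} (∈-allFin↓ j) (there (here refl)))
  ∈-exits (at (gate j) 0F)  ()
  ∈-exits (at (gate j) 1F)  ()
  ∈-exits (at (gate j) 2F)  ()
  ∈-exits (at (gate j) 3F)  ()
  ∈-exits (at (gate j) 4F)  ()
  ∈-exits (at (gate j) 5F)  ()
  ∈-exits (at (gate j) 6F)  ()
  ∈-exits (at (gate j) 8F)  ()
  ∈-exits (at (gate j) 9F)  ()

  exits-exit : ∀ {a} → a ∈ exits → exit a ≢ nothing
  exits-exit a∈ eq with ∈-++⁻ (cartesianProductWith gateExit (allFin↓ n) (true ∷ false ∷ [])) a∈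
  ... | inj₁ a∈ᵍ with ∈-cartesianProductWith⁻ gateExit (allFin↓ n) (true ∷ false ∷ []) a∈ᵍ
  ...   | _ , true  , _ , _ , refl with () ← eq
  ...   | _ , false , _ , _ , refl with () ← eq
  exits-exit a∈ eq | inj₂ a∈ᵇ with ∈-map⁻ embed a∈ᵇ
  ...   | b , b∈ , refl
    with exit₀ b | proj₂ (∈-filter⁻ isExit₀? {xs = locs₀} b∈) | trans (sym (exit-embed b)) eq
  ...     | just _  | _ | ()
  ...     | nothing | () | _

  edge : ALoc → Loc kit gadgets (suc N + n) × Loc kit gadgets (suc N + n)
  edge a = ι a , ι (next a)

  tails : ∀ as → map proj₁ (map edge as) ≡ map ι as
  tails as = sym (map-∘ as)

  system : System kit
  system = record
    { gadgets   = gadgets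
    ; #spawners = suc N + n
    ; edges     = map edge exits
    ; outdegree = subst Unique (sym (tails exits)) (Unique.map⁺ ι-injective unique-exits)
    ; one-way   = Allₚ.map⁺ (All.universal no-exit exits)
    }
    where
    no-exit : ∀ a → ι (next a) ∉ map proj₁ (map edge exits)
    no-exit a ∈ with ∈-map⁻ ι (subst (ι (next a) ∈_) (tails exits) ∈)
    ... | b , b∈ , eq with ι-injective eq
    ... | refl = exits-exit b∈ (exit-next a)

  open System system using (States; follow; traverse; turn; set; initial) renaming (_≟_ to _≟ᴸ_)

  follow-ι : ∀ a → follow (ι a) ≡ ι (next a)
  follow-ι a = go exits (∈-exits a)
    where
    go : ∀ es → (∀ {b} → exit a ≡ just b → a ∈ es) →
         fromMaybe (ι a) (List.head (map proj₂ (filter (λ e → proj₁ e ≟ᴸ ι a) (map edge es)))) ≡ ι (next a)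
    go [] a∈ with exit a
    ... | nothing = refl
    ... | just _  with () ← a∈ refl
    go (b ∷ es) a∈ with ι b ≟ᴸ ι a
    ... | yes eq = cong (ι ∘ next) (ι-injective eq)
    ... | no ≢   = go es (λ eq → drop (a∈ eq))
      where
      drop : a ∈ b ∷ es → a ∈ es
      drop (here refl) = contradiction refl ≢
      drop (there a∈)  = a∈

  get : States → (g : Idx) → St g
  get σ g = subst StAt (lookup-idx g) (σ (idx g))

  put : (g : Idx) → St g → States → States
  put g s = set (idx g) (subst StAt (sym (lookup-idx g)) s)

  get-put-same : ∀ g s σ → get (put g s σ) g ≡ s
  get-put-same g s σ =
    trans (cong (subst StAt (lookup-idx g)) (set-same system (idx g) _ σ)) (subst-subst-sym (lookup-idx g))

  get-put-other : ∀ {g h} s σ → g ≢ h → get (put g s σ) h ≡ get σ h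
  get-put-other {g} {h} s σ g≢h =
    cong (subst StAt (lookup-idx h)) (set-other system _ σ (g≢h ∘ idx-injective))

  -- The equation between copies is a variable here and can be matched with `refl`; it is
  -- instantiated with `lookup-idx g` afterwards.
  transition-subst : ∀ {c d : Copy kit} (eq : c ≡ d) (s : StAt c) (a : LocAt d) →
    transition (Vec.lookup kit (proj₁ c)) s (subst LocAt (sym eq) a) ≡
    Maybe.map (λ (s′ , b) → subst StAt (sym eq) s′ , subst LocAt (sym eq) b)
              (transition (Vec.lookup kit (proj₁ d)) (subst StAt eq s) a)
  transition-subst {c} refl s a with transition (Vec.lookup kit (proj₁ c)) s a
  ... | nothing = refl
  ... | just _  = refl

  turn-stuck : ∀ {σ a g l} → next a ≡ at g l → transition (gadget g) (get σ g) l ≡ nothing →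
               turn σ (ι a) ≡ (σ , ι (at g l))
  turn-stuck {σ} {a} {g} {l} e t =
    trans (cong (traverse σ) (trans (follow-ι a) (cong ι e)))
          (traverse-nothing system (trans (transition-subst (lookup-idx g) (σ (idx g)) l)
                                          (cong (Maybe.map _) t)))

  turn-traverse : ∀ {σ a g l s b} → next a ≡ at g l → transition (gadget g) (get σ g) l ≡ just (s , b) →
                  turn σ (ι a) ≡ (put g s σ , ι (at g b))
  turn-traverse {σ} {a} {g} {l} e t =
    trans (cong (traverse σ) (trans (follow-ι a) (cong ι e)))
          (traverse-just system (trans (transition-subst (lookup-idx g) (σ (idx g)) l)
                                       (cong (Maybe.map _) t)))

  get-initial : ∀ g → get initial g ≡ init g
  get-initial g = go (lookup-idx g)
    where
    go : ∀ {c d : Copy kit} (eq : c ≡ d) → subst StAt eq (proj₂ c) ≡ proj₂ d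
    go refl = refl

  realisation : Realisation system
  realisation = record
    { _≟ᴵ_          = λ g h → map′ idx-injective (cong idx) (idx g Finₚ.≟ idx h)
    ; ι             = ι
    ; ι-injective   = ι-injective
    ; follow-ι      = follow-ι
    ; get           = get
    ; put           = put
    ; get-put-same  = get-put-same
    ; get-put-other = get-put-other
    ; get-initial   = get-initial
    ; turn-stuck    = turn-stuck
    ; turn-traverse = turn-traverse
    ; spawners      = trans (map-tabulate id inj₁)
        (trans (tabulate-+ (suc N) inj₁)
          (sym (cong₂ _++_ (map-tabulate id (ι ∘ sp)) (map-tabulate id (ι ∘ gsp)))))
    }

-- The dynamics of the system

module Dynamics (prog : List Instr) (n : ℕ)
                (S : System kit) (real : Wiring.Realisation prog n S) where

  open Layout prog
  open Wiring prog n
  open Machine prog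
  open System S hiding (_≟_)
  open Realisation real

  X : Set
  X = (g : Idx) → St g

  infixl 9 _[_≔_]

  _[_≔_] : X → (g : Idx) → St g → X
  (x [ g ≔ s ]) h with g ≟ᴵ h
  ... | yes refl = s
  ... | no  _    = x h

  ≔-same : ∀ x g s → (x [ g ≔ s ]) g ≡ s
  ≔-same x g s with g ≟ᴵ g
  ... | yes refl = refl
  ... | no  ≢    = contradiction refl ≢

  ≔-other : ∀ x {g h} s → g ≢ h → (x [ g ≔ s ]) h ≡ x h
  ≔-other x {g} {h} s g≢h with g ≟ᴵ h
  ... | yes g≡h = contradiction g≡h g≢h
  ... | no  _   = refl

  ≔-id : ∀ x {g s} → x g ≡ s → ∀ h → (x [ g ≔ s ]) h ≡ x h
  ≔-id x {g} eq h with g ≟ᴵ h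
  ... | yes refl = sym eq
  ... | no  _    = refl

  ≔-restore : ∀ x {g s s′} → x g ≡ s′ → ∀ h → (x [ g ≔ s ] [ g ≔ s′ ]) h ≡ x h
  ≔-restore x {g} {s} eq h with g ≟ᴵ h
  ... | yes refl = sym eq
  ... | no  ≢    = ≔-other x s ≢

  infix 4 _∼_

  _∼_ : States → X → Set
  σ ∼ x = ∀ g → get σ g ≡ x g

  put-∼ : ∀ {σ x} g s → σ ∼ x → put g s σ ∼ x [ g ≔ s ]
  put-∼ {σ} {x} g s σ∼x h = go (g ≟ᴵ h)
    where
    go : Dec (g ≡ h) → get (put g s σ) h ≡ (x [ g ≔ s ]) h
    go (yes refl) = trans (get-put-same g s σ) (sym (≔-same x g s))
    go (no g≢h)   = trans (get-put-other s σ g≢h) (trans (σ∼x h) (sym (≔-other x s g≢h)))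

  turn-traverse-∼ : ∀ {σ x a g l s b} → σ ∼ x → next a ≡ at g l →
                    transition (gadget g) (x g) l ≡ just (s , b) →
                    turn σ (ι a) ≡ (put g s σ , ι (at g b))
  turn-traverse-∼ {g = g} {l} σ∼x e t =
    turn-traverse e (trans (cong (λ s → transition (gadget g) s l) (σ∼x g)) t)

  -- The entrances at which robots wait.
  data Pile : Set where
    cell : Fin R → Pile
    feed : Fin (suc N) → Pile
    gate : Fin n → Pile

  owner : Pile → Idx
  owner (cell k) = base (cell k)
  owner (feed i) = base (feed i)
  owner (gate j) = gate j

  owner-injective : ∀ {p q} → owner p ≡ owner q → p ≡ q
  owner-injective {cell k} {cell k} refl = refl
  owner-injective {feed i} {feed i} refl = refl
  owner-injective {gate j} {gate j} refl = refl

  _≟ᴾ_ : DecidableEquality Pile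
  p ≟ᴾ q = map′ owner-injective (cong owner) (owner p ≟ᴵ owner q)

  door : (p : Pile) → Fin (#locations (gadget (owner p)))
  door (cell k) = Register.e
  door (feed i) = Increment.e
  door (gate j) = Increment.e

  mouth : Pile → ALoc
  mouth p = at (owner p) (door p)

  next-mouth : ∀ p → next (mouth p) ≡ mouth p
  next-mouth (cell k)               = refl
  next-mouth (feed 0F)              = refl
  next-mouth (feed (Fin.suc _))     = refl
  next-mouth (gate j)               = refl

  shut : (p : Pile) → St (owner p)
  shut (cell k) = 0F
  shut (feed i) = 0F
  shut (gate j) = 0F

  Shut : X → Pile → Set
  Shut x p = x (owner p) ≡ shut p

  transition-shut : ∀ p → transition (gadget (owner p)) (shut p) (door p) ≡ nothing
  transition-shut (cell k) = refl
  transition-shut (feed i) = refl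
  transition-shut (gate j) = refl

  -- A robot still at a spawner or at the exit of an increment gadget already counts as waiting at
  -- the door to which its edge leads.
  Parked : Location → Pile → Set
  Parked l p = Σ[ a ∈ ALoc ] l ≡ ι a × next a ≡ mouth p

  turn-shut : ∀ {σ x l p} → σ ∼ x → Shut x p → Parked l p → turn σ l ≡ (σ , ι (mouth p))
  turn-shut {p = p} σ∼x s (a , refl , e) =
    turn-stuck e (trans (cong (λ s → transition (gadget (owner p)) s (door p)) (trans (σ∼x _) s))
                        (transition-shut p))

  parked-mouth : ∀ p → Parked (ι (mouth p)) p
  parked-mouth p = mouth p , refl , next-mouth p

  Round : States → List Location → X → List Pile → Set
  Round σ as x ps = ∃[ σ′ ] ∃[ as′ ] turns σ as ≡ (σ′ , as′) × σ′ ∼ x × Pointwise Parked as′ ps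

  turns-shut : ∀ {σ x as ps} → σ ∼ x → Pointwise Parked as ps → All (Shut x) ps → Round σ as x ps
  turns-shut σ∼x []       []       = _ , _ , refl , σ∼x , []
  turns-shut σ∼x (_∷_ {y = p} a as) (s ∷ ss) with turns-shut σ∼x as ss
  ... | _ , _ , e , σ′∼ , as′ =
    _ , _ , turns-∷ S (turn-shut σ∼x s a) e , σ′∼ , parked-mouth p ∷ as′

  -- The first robot of pile p joins pile q.
  data Send (p q : Pile) : List Pile → List Pile → Set where
    here  : ∀ {ps} → Send p q (p ∷ ps) (q ∷ ps)
    there : ∀ {r ps qs} → r ≢ p → Send p q ps qs → Send p q (r ∷ ps) (r ∷ qs)

  ∈⇒Send : ∀ {p} q {ps} → p ∈ ps → ∃[ qs ] Send p q ps qs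
  ∈⇒Send {p} q {r ∷ ps} p∈ with r ≟ᴾ p | p∈
  ... | yes refl | _         = _ , here
  ... | no  r≢p  | here refl = contradiction refl r≢p
  ... | no  r≢p  | there p∈′ with ∈⇒Send q p∈′
  ...   | _ , s = _ , there r≢p s

  module _ {x p q l} (open-p : transition (gadget (owner p)) (x (owner p)) (door p) ≡ just (shut p , l))
           (to-q : next (at (owner p) l) ≡ mouth q)
           (shut-rest : ∀ r → r ≢ p → Shut x r) where

    -- Robots before the first one of `p` belong to shut piles. Its passage shuts `p` again, so the
    -- robots after it find every pile shut.
    turns-send : ∀ {σ as ps qs} → σ ∼ x → Pointwise Parked as ps → Send p q ps qs →
                 Round σ as (x [ owner p ≔ shut p ]) qs
    turns-send {σ} {ps = _ ∷ ps} σ∼x ((a , refl , e) ∷ as) here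
      with turns-shut (put-∼ {σ} {x} (owner p) (shut p) σ∼x) as (All.universal shut-all ps)
      where
      shut-all : ∀ r → Shut (x [ owner p ≔ shut p ]) r
      shut-all r with r ≟ᴾ p
      ... | yes refl = ≔-same x (owner p) (shut p)
      ... | no  r≢p  = trans (≔-other x (shut p) (λ e → r≢p (sym (owner-injective e)))) (shut-rest r r≢p)
    ... | _ , _ , es , σ′∼ , as′ =
      _ , _ , turns-∷ S (turn-traverse-∼ {x = x} σ∼x e open-p) es , σ′∼ , (_ , refl , to-q) ∷ as′
    turns-send σ∼x (_∷_ {y = r} a as) (there r≢p s) with turns-send σ∼x as s
    ... | _ , _ , es , σ′∼ , as′ =
      _ , _ , turns-∷ S (turn-shut σ∼x (shut-rest r r≢p) a) es , σ′∼ , parked-mouth r ∷ as′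

  holds : Fin R → Pile → ℕ
  holds k (cell k′) = if k Finₚ.≟ k′ then 1 else 0
  holds k (feed _)  = 0
  holds k (gate _)  = 0

  count : Fin R → List Pile → ℕ
  count k []       = 0
  count k (p ∷ ps) = holds k p + count k ps

  count-++ : ∀ k ps qs → count k (ps ++ qs) ≡ count k ps + count k qs
  count-++ k []       qs = refl
  count-++ k (p ∷ ps) qs = trans (cong (holds k p +_) (count-++ k ps qs)) (sym (+-assoc (holds k p) _ _))

  +-swap : ∀ a b c → a + (b + c) ≡ b + (a + c)
  +-swap a b c = trans (sym (+-assoc a b c)) (trans (cong (_+ c) (+-comm a b)) (+-assoc b a c))

  count-send : ∀ {p q ps qs} k → Send p q ps qs → holds k q + count k ps ≡ holds k p + count k qs
  count-send {p} {q} k (here {ps})      = +-swap (holds k q) (holds k p) (count k ps)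
  count-send {p} {q} k (there {r} {ps} {qs} _ s) =
    trans (+-swap (holds k q) (holds k r) (count k ps))
      (trans (cong (holds k r +_) (count-send k s)) (+-swap (holds k r) (holds k p) (count k qs)))

  holds-self : ∀ k → holds k (cell k) ≡ 1
  holds-self k with k Finₚ.≟ k
  ... | yes _ = refl
  ... | no ≢  = contradiction refl ≢

  count-∈ : ∀ k {m} ps → count k ps ≡ suc m → cell k ∈ ps
  count-∈ k (feed _ ∷ ps) e = there (count-∈ k ps e)
  count-∈ k (gate _ ∷ ps) e = there (count-∈ k ps e)
  count-∈ k (cell k′ ∷ ps) e with k Finₚ.≟ k′
  ... | yes refl = here refl
  ... | no  _    = there (count-∈ k ps e)

  count-∉ : ∀ k ps → count k ps ≡ 0 → cell k ∉ ps
  count-∉ k (p ∷ ps) e (here refl) with () ← trans (sym (cong (_+ count k ps) (holds-self k))) e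
  count-∉ k (feed _ ∷ ps)  e (there k∈) = count-∉ k ps e k∈
  count-∉ k (gate _ ∷ ps)  e (there k∈) = count-∉ k ps e k∈
  count-∉ k (cell k′ ∷ ps) e (there k∈) with k Finₚ.≟ k′ | e
  ... | no _ | e′ = count-∉ k ps e′ k∈

  spawns : List Location
  spawns = map inj₁ (allFin #spawners)

  spawned : List Pile
  spawned = map feed (allFin (suc N)) ++ map gate (allFin n)

  parked-sp : ∀ is → Pointwise Parked (map (ι ∘ sp) is) (map feed is)
  parked-sp []       = []
  parked-sp (i ∷ is) = (sp i , refl , refl) ∷ parked-sp is

  parked-gsp : ∀ js → Pointwise Parked (map (ι ∘ gsp) js) (map gate js)
  parked-gsp []       = []
  parked-gsp (j ∷ js) = (gsp j , refl , refl) ∷ parked-gsp js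

  parked-spawns : Pointwise Parked spawns spawned
  parked-spawns = subst (λ as → Pointwise Parked as spawned) (sym spawners)
    (Pw.++⁺ (parked-sp (allFin (suc N))) (parked-gsp (allFin n)))

  count-feeds : ∀ k is → count k (map feed is) ≡ 0
  count-feeds k []       = refl
  count-feeds k (_ ∷ is) = count-feeds k is

  count-gates : ∀ k js → count k (map gate js) ≡ 0
  count-gates k []       = refl
  count-gates k (_ ∷ js) = count-gates k js

  count-spawned : ∀ k → count k spawned ≡ 0
  count-spawned k = trans (count-++ k (map feed (allFin (suc N))) _)
    (cong₂ _+_ (count-feeds k (allFin (suc N))) (count-gates k (allFin n)))

  feed∈spawned : ∀ i → feed i ∈ spawned
  feed∈spawned i = ∈-++⁺ˡ (∈-map⁺ feed (∈-allFin i))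

  -- `robots` puts the program robot first in the turn order. The spawners renew `stocked` in every
  -- round, so an increment never lacks a robot to release.
  record World (a : ALoc) (x : X) (ρ : Store) (c : Config) : Set where
    field
      others  : List Location
      piles   : List Pile
      robots  : proj₂ c ≡ ι a ∷ others
      parked  : Pointwise Parked others piles
      state   : proj₁ c ∼ x
      counts  : ∀ k → count k piles ≡ ρ (toℕ k)
      stocked : ∀ i → feed i ∈ piles

  open World

  respects : ∀ {a x y ρ c} → (∀ g → x g ≡ y g) → World a x ρ c → World a y ρ c
  respects x≗y w = record { World w ; state = λ g → trans (state w g) (x≗y g) }

  after-round : ∀ {σ a as σ₁ b x ps ρ} → turn σ (ι a) ≡ (σ₁ , ι b) → Round σ₁ as x ps →
                (∀ k → count k ps ≡ ρ (toℕ k)) → World b x ρ (round (σ , ι a ∷ as))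
  after-round {σ} {a} {as} {x = x} {ps} t (σ₂ , as′ , ts , σ₂∼ , parked′) counts′ = record
    { others  = as′ ++ spawns
    ; piles   = ps ++ spawned
    ; robots  = cong proj₂ rounds
    ; parked  = Pw.++⁺ parked′ parked-spawns
    ; state   = subst (_∼ x) (sym (cong proj₁ rounds)) σ₂∼
    ; counts  = λ k → trans (count-++ k ps spawned)
                  (trans (cong (count k ps +_) (count-spawned k)) (trans (+-identityʳ _) (counts′ k)))
    ; stocked = λ i → ∈-++⁺ʳ ps (feed∈spawned i)
    }
    where
    rounds : round (σ , ι a ∷ as) ≡ (σ₂ , _ ∷ as′ ++ spawns)
    rounds = round-turns S {σ} {ι a ∷ as} (turns-∷ S {σ} {ι a} {as} t ts)

  -- In a test for zero the register stays open at the end of the round, which is harmless as nobody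
  -- waits there.
  Vacant : Store → Pile → Set
  Vacant ρ p = Σ[ k ∈ Fin R ] p ≡ cell k × ρ (toℕ k) ≡ 0

  round-quiet : ∀ {a x ρ c g l s b} → World a x ρ c → next a ≡ at g l →
                transition (gadget g) (x g) l ≡ just (s , b) →
                (∀ p → Shut (x [ g ≔ s ]) p ⊎ Vacant ρ p) →
                World (at g b) (x [ g ≔ s ]) ρ (round c)
  round-quiet {x = x} {c = σ , _} {g} {s = s} w@record { robots = refl } e t shut-or-vacant =
    after-round (turn-traverse-∼ {x = x} (state w) e t)
      (turns-shut (put-∼ {σ} {x} g s (state w)) (parked w) (All.tabulate shut-pile)) (counts w)
    where
    shut-pile : ∀ {p} → p ∈ piles w → Shut (x [ g ≔ s ]) p
    shut-pile {p} p∈ with shut-or-vacant p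
    ... | inj₁ shut-p            = shut-p
    ... | inj₂ (k , refl , ρk≡0) = contradiction p∈ (count-∉ k (piles w) (trans (counts w k) ρk≡0))

  -- The program robot opens `p` and the oldest robot there shuts it, so `x` is restored within one
  -- round. The last hypothesis is additive to avoid subtraction.
  round-send : ∀ {a x ρ c} p {q l s b d} ρ′ → (w : World a x ρ c) → next a ≡ at (owner p) l →
               transition (gadget (owner p)) (x (owner p)) l ≡ just (s , b) →
               transition (gadget (owner p)) s (door p) ≡ just (shut p , d) →
               next (at (owner p) d) ≡ mouth q →
               (∀ r → Shut x r) → p ∈ piles w →
               (∀ k → holds k q + ρ (toℕ k) ≡ holds k p + ρ′ (toℕ k)) →
               World (at (owner p) b) x ρ′ (round c)
  round-send {x = x} {c = σ , _} p {q} {s = s} ρ′ w@record { robots = refl } e t open-p to-q shut-all p∈ ρ≡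
    with ∈⇒Send q p∈
  ... | qs , send =
    respects (≔-restore x (shut-all p))
      (after-round (turn-traverse-∼ {x = x} (state w) e t)
        (turns-send {x [ owner p ≔ s ]} {p} {q}
          (trans (cong (λ s → transition (gadget (owner p)) s (door p)) (≔-same x (owner p) s)) open-p)
          to-q
          (λ r r≢p → trans (≔-other x s (λ e → r≢p (sym (owner-injective e)))) (shut-all r))
          (put-∼ {σ} {x} (owner p) s (state w)) (parked w) send)
        (λ k → +-cancelˡ-≡ (holds k p) _ _
                 (trans (sym (count-send k send)) (trans (cong (holds k q +_) (counts w k)) (ρ≡ k)))))

  target : Location
  target = ι (embed target₀)

  Hit : Config → Set
  Hit c = ∃[ l ] l ∈ proj₂ c × (target ≡ l ⊎ target ≡ follow l)

  ι-miss : ∀ {a} → next a ≢ embed target₀ → ¬ (target ≡ ι a ⊎ target ≡ follow (ι a))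
  ι-miss a≢ (inj₁ e) with ι-injective e
  ... | refl = a≢ refl
  ι-miss {a} a≢ (inj₂ e) = a≢ (sym (ι-injective (trans e (follow-ι a))))

  mouth≢target : ∀ p → mouth p ≢ embed target₀
  mouth≢target (cell _) ()
  mouth≢target (feed _) ()
  mouth≢target (gate _) ()

  parked-miss : ∀ {as ps} → Pointwise Parked as ps → ∀ {l} → l ∈ as → ¬ (target ≡ l ⊎ target ≡ follow l)
  parked-miss (_∷_ {y = p} (a , refl , e) as) (here refl) =
    ι-miss (λ e′ → mouth≢target p (trans (sym e) e′))
  parked-miss (_ ∷ as) (there l∈) = parked-miss as l∈

  miss : ∀ {a x ρ c} → World a x ρ c → next a ≢ embed target₀ → ¬ Hit c
  miss w@record { robots = refl } a≢ (_ , here refl , h) = ι-miss a≢ h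
  miss w@record { robots = refl } a≢ (_ , there l∈ , h)  = parked-miss (parked w) l∈ h

  -- Simulation of the counter machine

  data HitsIn : ℕ → Config → Set where
    now   : ∀ {m c} → Hit c → HitsIn m c
    later : ∀ {m c} → HitsIn m (round c) → HitsIn (suc m) c

  infix 4 _↝⁺_
  infixr 5 _∷_

  -- At least one round, and no hit before the last configuration: so `hits-after` strictly lowers
  -- the bound.
  data _↝⁺_ : Config → Config → Set where
    [_] : ∀ {c} → ¬ Hit c → c ↝⁺ round c
    _∷_ : ∀ {c c′} → ¬ Hit c → round c ↝⁺ c′ → c ↝⁺ c′

  infixr 5 _◅◅_

  _◅◅_ : ∀ {c c′ c″} → c ↝⁺ c′ → c′ ↝⁺ c″ → c ↝⁺ c″
  [ m ]    ◅◅ r = m ∷ r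
  (m ∷ r′) ◅◅ r = m ∷ (r′ ◅◅ r)

  hits-before : ∀ {c c′ m} → c ↝⁺ c′ → HitsIn m c′ → ∃[ m′ ] HitsIn m′ c
  hits-before [ _ ]   h = _ , later h
  hits-before (_ ∷ r) h = _ , later (proj₂ (hits-before r h))

  hits-after : ∀ {c c′ m} → c ↝⁺ c′ → HitsIn m c → ∃[ m′ ] m′ < m × HitsIn m′ c′
  hits-after [ ¬h ]   (now h)   = contradiction h ¬h
  hits-after [ _ ]    (later h) = _ , n<1+n _ , h
  hits-after (¬h ∷ _) (now h)   = contradiction h ¬h
  hits-after (_ ∷ r)  (later h) with hits-after r h
  ... | m′ , m′< , h′ = m′ , m<n⇒m<1+n m′< , h′

  idle : X
  idle (base (cell _)) = Register.O
  idle (base (flag _)) = UPDSDS.down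
  idle (base (feed _)) = 0F
  idle (gate _)        = 0F

  idle-shut : ∀ p → Shut idle p
  idle-shut (cell _) = refl
  idle-shut (feed _) = refl
  idle-shut (gate _) = refl

  raised : Fin N → X
  raised p = idle [ base (flag p) ≔ UPDSDS.up ]

  raised-shut : ∀ p r → Shut (raised p) r
  raised-shut p r = trans (≔-other idle _ (flag≢owner r)) (idle-shut r)
    where
    flag≢owner : ∀ r → base (flag p) ≢ owner r
    flag≢owner (cell _) ()
    flag≢owner (feed _) ()
    flag≢owner (gate _) ()

  Ready : ℕ → Store → Config → Set
  Ready ℓ ρ c = Σ[ a ∈ ALoc ] World a idle ρ c × next a ≡ embed (entry ℓ)

  miss-at : ∀ {a x ρ c g l} → World a x ρ c → next a ≡ at g l → at g l ≢ embed target₀ → ¬ Hit c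
  miss-at w e l≢ = miss w (λ e′ → l≢ (trans (sym e) e′))

  flag-injective : ∀ {p q} → base (flag p) ≡ base (flag q) → p ≡ q
  flag-injective refl = refl

  chain-at : ∀ x q → chain x (toℕ q) ≡ at (flag q) x
  chain-at x q with toℕ q <? N
  ... | yes q<N = cong (λ q → at (flag q) x) (fromℕ<-toℕ q q<N)
  ... | no  q≮N = contradiction (toℕ<n q) q≮N

  entry-at : ∀ p → entry (toℕ p) ≡ start (instr p) p
  entry-at p with toℕ p <? N
  ... | yes p<N = cong (λ p → start (instr p) p) (fromℕ<-toℕ p p<N)
  ... | no  p≮N = contradiction (toℕ<n p) p≮N

  module _ {x u d}
    (switch-up   : UPDSDS.step UPDSDS.up x ≡ just (UPDSDS.down , u))
    (switch-down : UPDSDS.step UPDSDS.down x ≡ just (UPDSDS.down , d))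
    (pass        : ∀ q → next (at (base (flag q)) d) ≡ embed (chain x (suc (toℕ q)))) where

    -- The switch of flag `j` comes next, and `k` lowered flags precede flag `p`. The traversal that
    -- leaves the chain at `p` also lowers that flag, so all gadgets end idle.
    walk : ∀ p k j {a ρ c} → j + k ≡ toℕ p → World a (raised p) ρ c → next a ≡ embed (chain x j) →
           ∃[ c′ ] c ↝⁺ c′ × World (at (base (flag p)) u) idle ρ c′
    walk p zero j {a} j≡ w e = _ , [ miss-at w e′ (λ ()) ] ,
      respects (≔-restore idle refl)
        (round-quiet w e′ (trans (cong (λ s → UPDSDS.step s x) (≔-same idle (base (flag p)) UPDSDS.up)) switch-up)
          (λ r → inj₁ (trans (≔-restore idle refl (owner r)) (idle-shut r))))
      where
      e′ : next a ≡ at (base (flag p)) x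
      e′ = trans e (cong embed (trans (cong (chain x) (trans (sym (+-identityʳ j)) j≡)) (chain-at x p)))
    walk p (suc k) j {a} j≡ w e =
      let c′ , r , w′ = walk p k (suc j) (trans (sym (+-suc j k)) j≡)
                          (respects (≔-id (raised p) down)
                            (round-quiet w e′ (trans (cong (λ s → UPDSDS.step s x) down) switch-down)
                              (λ r → inj₁ (trans (≔-id (raised p) down (owner r)) (raised-shut p r)))))
                          (trans (pass q) (cong (λ j → embed (chain x (suc j))) q≡j))
      in  c′ , miss-at w e′ (λ ()) ∷ r , w′
      where
      j<p : j < toℕ p
      j<p = subst (j <_) j≡ (m<m+n j (s≤s z≤n))
      j<N : j < N
      j<N = <-trans j<p (toℕ<n p)
      q = fromℕ< j<N
      q≡j : toℕ q ≡ j
      q≡j = toℕ-fromℕ< j<N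
      e′ : next a ≡ at (base (flag q)) x
      e′ = trans e (cong embed (trans (cong (chain x) (sym q≡j)) (chain-at x q)))
      down : raised p (base (flag q)) ≡ UPDSDS.down
      down = ≔-other idle _ (λ e → <⇒≢ j<p (trans (sym q≡j) (cong toℕ (sym (flag-injective e)))))

  advance-inc : ∀ {ℓ r ℓ′ ρ c} → Fetch ℓ (inc r ℓ′) → Ready ℓ ρ c →
                ∃[ c′ ] c ↝⁺ c′ × Ready ℓ′ (ρ [ r ↦ suc (ρ r) ]) c′
  advance-inc {r = r} {ℓ′} {ρ} {c} (p , refl , p≡) (a , w , e) =
    round c , [ miss-at w e′ (λ ()) ] , _ ,
    round-send (feed (Fin.suc p)) {cell (regAt p)} (ρ [ r ↦ suc (ρ r) ]) w e′ refl refl refl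
      idle-shut (stocked w (Fin.suc p)) counts′ ,
    cong (λ i → embed (entry (nzOf i))) p≡
    where
    e′ : next a ≡ at (base (feed (Fin.suc p))) Increment.p₁
    e′ = trans e (cong embed (trans (entry-at p) (cong (λ i → start i p) p≡)))
    r≡ : toℕ (regAt p) ≡ r
    r≡ = trans (toℕ-regAt p) (cong regOf p≡)
    counts′ : ∀ k → holds k (cell (regAt p)) + ρ (toℕ k) ≡ (ρ [ r ↦ suc (ρ r) ]) (toℕ k)
    counts′ k with k Finₚ.≟ regAt p | toℕ k ≟ r
    ... | yes refl | yes refl = refl
    ... | no _     | no _     = refl
    ... | yes refl | no k≢r   = contradiction r≡ k≢r
    ... | no k≢    | yes refl = contradiction (toℕ-injective (sym r≡)) k≢

  module _ {ℓ r nz z ρ c} (f : Fetch ℓ (test r nz z)) (ready : Ready ℓ ρ c) where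

    private
      p  = proj₁ f
      k  = regAt p
      p≡ = proj₂ (proj₂ f)
      w  = proj₁ (proj₂ ready)

      r≡ : toℕ k ≡ r
      r≡ = trans (toℕ-regAt p) (cong regOf p≡)

      e : next (proj₁ ready) ≡ at (base (flag p)) UPDSDS.t-in
      e = trans (proj₂ (proj₂ ready)) (cong embed (trans (cong entry (sym (proj₁ (proj₂ f))))
            (trans (entry-at p) (cong (λ i → start i p) p≡))))

      w₁ : World (at (base (flag p)) UPDSDS.t-out) (raised p) ρ (round c)
      w₁ = round-quiet w e refl (λ r → inj₁ (raised-shut p r))

      cell-step : ∀ {l t} → Register.step Register.O l ≡ t →
                  Register.step (raised p (base (cell k))) l ≡ t
      cell-step {l} = trans (cong (λ s → Register.step s l) (raised-shut p (cell k)))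

    -- Raising the flag, discarding a robot into the pile of `feed 0F` and reading the response take
    -- a round each; then comes the chain of first switches.
    advance-nonzero : ∀ {m} → ρ r ≡ suc m → ∃[ c′ ] c ↝⁺ c′ × Ready nz (ρ [ r ↦ m ]) c′
    advance-nonzero {m} ρr≡ =
      let w₂ = round-send (cell k) {feed 0F} (ρ [ r ↦ m ]) w₁ refl (cell-step refl) refl refl
                 (raised-shut p) (count-∈ k (piles w₁) (trans (counts w₁ k) (trans (cong ρ r≡) ρr≡))) counts′
          w₃ = respects (≔-id (raised p) (raised-shut p (cell k)))
                 (round-quiet w₂ refl (cell-step refl)
                   (λ r → inj₁ (trans (≔-id (raised p) (raised-shut p (cell k)) (owner r)) (raised-shut p r))))
          c′ , s , w₄ = walk refl refl (λ _ → refl) p (toℕ p) 0 refl w₃ refl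
      in  c′ , miss-at w e (λ ()) ∷ miss-at w₁ refl (λ ()) ∷ miss-at w₂ refl (λ ()) ∷ s ,
          _ , w₄ , cong (λ i → embed (entry (nzOf i))) p≡
      where
      counts′ : ∀ k′ → ρ (toℕ k′) ≡ holds k′ (cell k) + (ρ [ r ↦ m ]) (toℕ k′)
      counts′ k′ with k′ Finₚ.≟ k | toℕ k′ ≟ r
      ... | yes refl | yes _    = trans (cong ρ r≡) ρr≡
      ... | no _     | no _     = refl
      ... | yes refl | no k≢r   = contradiction r≡ k≢r
      ... | no k≢    | yes k′≡r = contradiction (toℕ-injective (trans k′≡r (sym r≡))) k≢

    -- Nobody resets the register in the round of the test, so the response branch still finds `J`
    -- and resets it.
    advance-zero : ρ r ≡ 0 → ∃[ c′ ] c ↝⁺ c′ × Ready z ρ c′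
    advance-zero ρr≡ =
      let w₂ = round-quiet w₁ refl (cell-step refl) vacant
          w₃ = respects (≔-restore (raised p) (raised-shut p (cell k)))
                 (round-quiet w₂ refl
                   (cong (λ s → Register.step s Register.r) (≔-same (raised p) (base (cell k)) Register.J))
                   (λ r → inj₁ (trans (≔-restore (raised p) (raised-shut p (cell k)) (owner r))
                                      (raised-shut p r))))
          c′ , s , w₄ = walk refl refl (λ _ → refl) p (toℕ p) 0 refl w₃ refl
      in  c′ , miss-at w e (λ ()) ∷ miss-at w₁ refl (λ ()) ∷ miss-at w₂ refl (λ ()) ∷ s ,
          _ , w₄ , cong (λ i → embed (entry (zOf i))) p≡
      where
      vacant : ∀ q → Shut (raised p [ base (cell k) ≔ Register.J ]) q ⊎ Vacant ρ q
      vacant q with q ≟ᴾ cell k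
      ... | yes refl = inj₂ (k , refl , trans (cong ρ r≡) ρr≡)
      ... | no q≢    = inj₁
        (trans (≔-other (raised p) Register.J (λ e → q≢ (sym (owner-injective {cell k} {q} e))))
               (raised-shut p q))

  halts⇒hits : ∀ {t ℓ ρ c} → Halts t ℓ ρ → Ready ℓ ρ c → ∃[ m ] HitsIn m c
  halts⇒hits {ℓ = ℓ} (halt N≤ℓ) (a , w@record { robots = refl } , e) =
    0 , now (ι a , here refl , inj₂ (sym (trans (follow-ι a) (cong ι (trans e (cong embed entry≡))))))
    where
    entry≡ : entry ℓ ≡ target₀
    entry≡ with ℓ <? N
    ... | yes ℓ<N = contradiction N≤ℓ (<⇒≱ ℓ<N)
    ... | no  _   = refl
  halts⇒hits (inc f h) ready with advance-inc f ready
  ... | _ , s , ready′ = hits-before s (proj₂ (halts⇒hits h ready′))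
  halts⇒hits (zero f ρr≡ h) ready with advance-zero f ready ρr≡
  ... | _ , s , ready′ = hits-before s (proj₂ (halts⇒hits h ready′))
  halts⇒hits (nonzero f ρr≡ h) ready with advance-nonzero f ready ρr≡
  ... | _ , s , ready′ = hits-before s (proj₂ (halts⇒hits h ready′))

  -- An instruction takes several rounds, so the recursion is on a bound `b` for the rounds left,
  -- not on the hit itself.
  hits⇒halts : ∀ b {m ℓ ρ c} → m < b → HitsIn m c → Ready ℓ ρ c → ∃[ t ] Halts t ℓ ρ
  hits⇒halts (suc b) {ℓ = ℓ} {ρ} m<b h ready = go (ℓ <? N)
    where
    step : ∀ i → Fetch ℓ i → ∃[ t ] Halts t ℓ ρ
    step (inc r ℓ′) f with advance-inc f ready
    ... | _ , s , ready′ with hits-after s h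
    ... | m′ , m′<m , h′ with hits⇒halts b (<-≤-trans m′<m (s≤s⁻¹ m<b)) h′ ready′
    ... | t , h″ = suc t , inc f h″
    step (test r nz z) f with ρ r in ρr≡
    ... | zero with advance-zero f ready ρr≡
    ... | _ , s , ready′ with hits-after s h
    ... | m′ , m′<m , h′ with hits⇒halts b (<-≤-trans m′<m (s≤s⁻¹ m<b)) h′ ready′
    ... | t , h″ = suc t , zero f ρr≡ h″
    step (test r nz z) f | suc m with advance-nonzero f ready ρr≡
    ... | _ , s , ready′ with hits-after s h
    ... | m′ , m′<m , h′ with hits⇒halts b (<-≤-trans m′<m (s≤s⁻¹ m<b)) h′ ready′
    ... | t , h″ = suc t , nonzero f ρr≡ h″

    go : Dec (ℓ < N) → ∃[ t ] Halts t ℓ ρ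
    go (no ℓ≮N)  = 0 , halt (≮⇒≥ ℓ≮N)
    go (yes ℓ<N) = step _ (fromℕ< ℓ<N , toℕ-fromℕ< ℓ<N , refl)

  -- Loading of the input

  closing : List (Fin n) → X → X
  closing []       x = x
  closing (j ∷ js) x = closing js (x [ gate j ≔ 0F ])

  closing-idle : ∀ js {x} g → x g ≡ idle g → closing js x g ≡ idle g
  closing-idle []       g e = e
  closing-idle (j ∷ js) {x} g e = closing-idle js g (close (gate j ≟ᴵ g))
    where
    close : Dec (gate j ≡ g) → (x [ gate j ≔ 0F ]) g ≡ idle g
    close (yes refl) = ≔-same x (gate j) 0F
    close (no j≢)    = trans (≔-other x 0F j≢) e

  closing-∈ : ∀ {js j x} → j ∈ js → closing js x (gate j) ≡ 0F
  closing-∈ {j ∷ js} {x = x} (here refl) = closing-idle js (gate j) (≔-same x (gate j) 0F)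
  closing-∈ {_ ∷ js}         (there j∈)  = closing-∈ j∈

  -- As the gates are distinct, each is still open when its own robot arrives.
  turns-gates : ∀ js {σ x} → σ ∼ x → Unique js → All (λ j → x (gate j) ≡ 1F) js →
                Round σ (map (ι ∘ gsp) js) (closing js x) (map (const (cell 0F)) js)
  turns-gates []       σ∼x _ _ = _ , _ , refl , σ∼x , []
  turns-gates (j ∷ js) {σ} {x} σ∼x (j# ∷ js#) (open-j ∷ open-js)
    with turns-gates js (put-∼ {σ} {x} (gate j) 0F σ∼x) js# (All.zipWith still-open (j# , open-js))
    where
    still-open : ∀ {i} → j ≢ i × x (gate i) ≡ 1F → (x [ gate j ≔ 0F ]) (gate i) ≡ 1F
    still-open (j≢i , open-i) = trans (≔-other x 0F (λ { refl → j≢i refl })) open-i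
  ... | _ , _ , ts , σ′∼ , parked′ =
    _ , _ ,
    turns-∷ S {σ} {ι (gsp j)} {map (ι ∘ gsp) js}
      (turn-traverse-∼ {x = x} {gsp j} {gate j} {Increment.e} σ∼x refl
        (cong (λ s → Increment.step s Increment.e) open-j)) ts ,
    σ′∼ , (_ , refl , refl) ∷ parked′

  count-cell-0 : ∀ k (js : List (Fin n)) →
                 count k (map (const (cell 0F)) js) ≡ reg (length js ∷ []) (toℕ k)
  count-cell-0 0F          []       = refl
  count-cell-0 (Fin.suc k) []       = refl
  count-cell-0 0F          (_ ∷ js) = cong suc (count-cell-0 0F js)
  count-cell-0 (Fin.suc k) (_ ∷ js) = count-cell-0 (Fin.suc k) js

  -- The first round only spawns. In the second the program robot passes `feed 0F`, the robots of
  -- the other feeds stop at shut doors, and each gate lets one robot through and shuts before its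
  -- next robot comes.
  loaded : Ready 0 (reg (n ∷ [])) (after 2)
  loaded = at (base (feed 0F)) Increment.f₁ ,
    subst (λ as → World (at (base (feed 0F)) Increment.f₁) idle (reg (n ∷ [])) (round (initial , as)))
          (sym spawners)
          (respects closed (after-round first
            (_ , _ , turns-++ S (map (ι ∘ sp) feeds) ts ts′ , σ₂∼ , Pw.++⁺ parked₁ parked₂) counts′)) ,
    refl
    where
    feeds : List (Fin (suc N))
    feeds = tabulate Fin.suc

    x₁ : X
    x₁ = init [ base (feed 0F) ≔ 0F ]

    σ₁ : States
    σ₁ = put (base (feed 0F)) 0F initial

    first : turn initial (ι (sp 0F)) ≡ (σ₁ , ι (at (base (feed 0F)) Increment.f₁))
    first = turn-traverse-∼ {x = init} {sp 0F} {base (feed 0F)} {Increment.e} get-initial refl refl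

    feeds-shut : All (Shut x₁) (map feed feeds)
    feeds-shut = Allₚ.map⁺ (Allₚ.tabulate⁺ (λ _ → ≔-other init 0F (λ ())))

    round₁ : Round σ₁ (map (ι ∘ sp) feeds) x₁ (map feed feeds)
    round₁ = turns-shut (put-∼ {initial} {init} (base (feed 0F)) 0F get-initial) (parked-sp feeds) feeds-shut

    ts = proj₁ (proj₂ (proj₂ round₁))
    parked₁ = proj₂ (proj₂ (proj₂ (proj₂ round₁)))

    round₂ : Round (proj₁ round₁) (map (ι ∘ gsp) (allFin n)) (closing (allFin n) x₁)
                   (map (const (cell 0F)) (allFin n))
    round₂ = turns-gates (allFin n) (proj₁ (proj₂ (proj₂ (proj₂ round₁)))) (Unique.allFin⁺ n)
               (All.tabulate (λ _ → ≔-other init 0F (λ ())))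

    ts′ = proj₁ (proj₂ (proj₂ round₂))
    σ₂∼ = proj₁ (proj₂ (proj₂ (proj₂ round₂)))
    parked₂ = proj₂ (proj₂ (proj₂ (proj₂ round₂)))

    closed : ∀ g → closing (allFin n) x₁ g ≡ idle g
    closed (gate j)                      = closing-∈ (∈-allFin j)
    closed g@(base (cell _))             = closing-idle (allFin n) g (≔-other init 0F (λ ()))
    closed g@(base (flag _))             = closing-idle (allFin n) g (≔-other init 0F (λ ()))
    closed g@(base (feed 0F))            = closing-idle (allFin n) g (≔-same init g 0F)
    closed g@(base (feed (Fin.suc _)))   = closing-idle (allFin n) g (≔-other init 0F (λ ()))

    counts′ : ∀ k → count k (map feed feeds ++ map (const (cell 0F)) (allFin n)) ≡ reg (n ∷ []) (toℕ k)
    counts′ k = trans (count-++ k (map feed feeds) _)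
      (trans (cong₂ _+_ (count-feeds k feeds) (count-cell-0 k (allFin n)))
             (cong (λ m → reg (m ∷ []) (toℕ k)) (length-tabulate {n = n} id)))

  hitsIn⇒hit : ∀ {m} t → HitsIn m (after t) → ∃[ t′ ] Hit (after t′)
  hitsIn⇒hit t (now h)   = t , h
  hitsIn⇒hit t (later h) = hitsIn⇒hit (suc t) h

  hit⇒hitsIn : ∀ m t → Hit (after (m + t)) → HitsIn m (after t)
  hit⇒hitsIn zero    t h = now h
  hit⇒hitsIn (suc m) t h = later (hit⇒hitsIn m (suc t) (subst (Hit ∘ after) (sym (+-suc m t)) h))

  reached⇔halts : Reached target ⇔ (∃[ t ] Halts t 0 (reg (n ∷ [])))
  reached⇔halts = mk⇔ to from
    where
    to : Reached target → ∃[ t ] Halts t 0 (reg (n ∷ []))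
    to (0 , _ , () , _)
    -- All robots still stand at spawners, whose edges lead to piles.
    to (1 , _ , l∈ , h) = contradiction h (parked-miss parked-spawns l∈)
    to (suc (suc t) , h) =
      hits⇒halts (suc t) (n<1+n t) (hit⇒hitsIn t 2 (subst (Hit ∘ after) (+-comm 2 t) h)) loaded

    from : ∃[ t ] Halts t 0 (reg (n ∷ [])) → Reached target
    from (_ , h) = hitsIn⇒hit 2 (proj₂ (halts⇒hits h loaded))

-- Computability of the construction

codeList : List ℕ → ℕ
codeList = foldr consCode 0

code-List-map : ∀ {A : Set} (c : A ↣ ℕ) xs →
                Injection.to (code-List c) xs ≡ codeList (map (Injection.to c) xs)
code-List-map c []       = refl
code-List-map c (x ∷ xs) = cong (consCode (Injection.to c x)) (code-List-map c xs)

map-tabulate-const : ∀ {A B : Set} (b : B) n (f : Fin n → A) → map (const b) (tabulate f) ≡ replicate n b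
map-tabulate-const b zero    f = refl
map-tabulate-const b (suc n) f = cong (b ∷_) (map-tabulate-const b n (f ∘ Fin.suc))

code-Copy : Copy kit ↣ ℕ
code-Copy = code-Σ (code-Fin 3) (λ i → code-Fin (#states (Vec.lookup kit i)))

module Codes (prog : List Instr) where

  open Layout prog

  copyCode : Copy kit → ℕ
  copyCode = Injection.to code-Copy

  locCode₀ : Loc₀ → ℕ
  locCode₀ (sp i)   = pair 0 (toℕ i)
  locCode₀ (at g a) = pair 1 (pair (proj₁ (place₀ g)) (toℕ a))

  edgeCode₀ : Loc₀ → ℕ
  edgeCode₀ a = pair (locCode₀ a) (locCode₀ (fromMaybe a (exit₀ a)))

  gateCode : ℕ → ℕ → ℕ
  gateCode j a = pair 1 (pair (length idxs₀ + j) a)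

  -- The numbers 6 and 7 are the locations `e` and `f₁`; the spawners of the gates come after the
  -- `suc N` others.
  gspEdge f₁Edge : ℕ → ℕ
  gspEdge j = pair (pair 0 (suc N + j)) (gateCode j 6)
  f₁Edge  j = pair (gateCode j 7) (locCode₀ (at (cell 0F) Register.e))

  -- With this recursion, `edgesCode (suc n)` unfolds to two conses on `edgesCode n`, as
  -- `total-iterate` requires.
  gateEdges : List ℕ → List ℕ
  gateEdges []       = []
  gateEdges (j ∷ js) = gspEdge j ∷ f₁Edge j ∷ gateEdges js

  -- `pair 0 1` encodes a gate: an increment gadget in state 1. The gates end the gadget list, so
  -- the constant codes of the other gadgets are consed onto an iterated tail.
  gadgetsCode edgesCode instanceCode : ℕ → ℕ
  gadgetsCode n  = foldr consCode (codeList (replicate n (pair 0 1)))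
                     (map (λ g → copyCode (kind₀ g , init₀ g)) idxs₀)
  edgesCode n    = foldr consCode (codeList (map edgeCode₀ exits₀)) (gateEdges (downFrom n))
  instanceCode n = pair (pair (gadgetsCode n) (pair (suc N + n) (edgesCode n))) (locCode₀ target₀)

  total-instanceCode : Total {1} (instanceCode ∘ head)
  total-instanceCode = total-pair (total-pair gadgets-total (total-pair
    (total-+ (total-const (suc N)) total-head) edges-total)) (total-const (locCode₀ target₀))
    where
    gadgets-total : Total {1} (gadgetsCode ∘ head)
    gadgets-total = total-foldr (map (λ g → copyCode (kind₀ g , init₀ g)) idxs₀)
      (total-iterate {F = λ n → codeList (replicate n (pair 0 1))} {G = λ _ z → consCode (pair 0 1) z}
        (total-consCode (total-const (pair 0 1)) total-second) (λ _ → refl))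

    gate-total : ∀ a → Total {2} (λ xs → gateCode (head xs) a)
    gate-total a = total-pair (total-const 1)
      (total-pair (total-+ (total-const (length idxs₀)) total-head) (total-const a))

    edges-total : Total {1} (edgesCode ∘ head)
    edges-total = total-iterate {F = edgesCode} {G = λ j z → consCode (gspEdge j) (consCode (f₁Edge j) z)}
      (total-consCode
        (total-pair (total-pair (total-const 0) (total-+ (total-const (suc N)) total-head)) (gate-total 6))
        (total-consCode
          (total-pair (gate-total 7) (total-const (locCode₀ (at (cell 0F) Register.e)))) total-second))
      (λ _ → refl)

  module _ (n : ℕ) where

    open Wiring prog n
    open Network prog n

    locCode : ALoc → ℕ
    locCode (sp i)          = locCode₀ (sp i)
    locCode (gsp j)         = pair 0 (suc N + toℕ j)
    locCode (at (base g) a) = locCode₀ (at g a)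
    locCode (at (gate j) a) = gateCode (toℕ j) (toℕ a)

    locCode-embed : ∀ a → locCode (embed a) ≡ locCode₀ a
    locCode-embed (sp i)   = refl
    locCode-embed (at g a) = refl

    toℕ-subst : ∀ {c d} (eq : c ≡ d) (a : LocAt c) → toℕ (subst LocAt eq a) ≡ toℕ a
    toℕ-subst refl a = refl

    code-ι : ∀ a → Injection.to (code-Loc kit gadgets (suc N + n)) (ι a) ≡ locCode a
    code-ι (sp i)  = cong (pair 0) (toℕ-↑ˡ i n)
    code-ι (gsp j) = cong (pair 0) (toℕ-↑ʳ (suc N) j)
    code-ι (at (base g) a) = cong (pair 1)
      (cong₂ pair (toℕ-idx (base g)) (toℕ-subst (sym (lookup-idx (base g))) a))
    code-ι (at (gate j) a) = cong (pair 1)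
      (cong₂ pair (trans (toℕ-idx (gate j)) (cong (_+ toℕ j) (length-map base idxs₀)))
                  (toℕ-subst (sym (lookup-idx (gate j))) a))

    edgeCode : ALoc → ℕ
    edgeCode a = pair (locCode a) (locCode (next a))

    edgeCode-embed : ∀ a → edgeCode (embed a) ≡ edgeCode₀ a
    edgeCode-embed a = cong₂ pair (locCode-embed a)
      (trans (cong locCode (trans (cong (fromMaybe (embed a)) (exit-embed a)) (fromMaybe-embed (exit₀ a))))
             (locCode-embed (fromMaybe a (exit₀ a))))
      where
      fromMaybe-embed : ∀ m → fromMaybe (embed a) (Maybe.map embed m) ≡ embed (fromMaybe a m)
      fromMaybe-embed nothing  = refl
      fromMaybe-embed (just _) = refl

    gateEdges-exits : ∀ js →
      map edgeCode (cartesianProductWith gateExit js (true ∷ false ∷ [])) ≡ gateEdges (map toℕ js)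
    gateEdges-exits []       = refl
    gateEdges-exits (j ∷ js) = cong (λ es → gspEdge (toℕ j) ∷ f₁Edge (toℕ j) ∷ es) (gateEdges-exits js)

    code-gadgets : Injection.to (code-List code-Copy) gadgets ≡ gadgetsCode n
    code-gadgets =
      trans (code-List-map code-Copy gadgets)
      (trans (cong codeList codes)
             (foldr-++ consCode 0 (map (λ g → copyCode (kind₀ g , init₀ g)) idxs₀) _))
      where
      codes : map copyCode gadgets ≡
              map (λ g → copyCode (kind₀ g , init₀ g)) idxs₀ ++ replicate n (pair 0 1)
      codes = trans (sym (map-∘ idxs)) (trans (map-++ (copyCode ∘ copy) (map base idxs₀) (map gate (allFin n)))
        (cong₂ _++_ (sym (map-∘ idxs₀))
          (trans (sym (map-∘ (allFin n))) (map-tabulate-const (pair 0 1) n id))))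

    code-Edge : (Loc kit gadgets (suc N + n) × Loc kit gadgets (suc N + n)) ↣ ℕ
    code-Edge = code-Σ (code-Loc kit gadgets (suc N + n)) (λ _ → code-Loc kit gadgets (suc N + n))

    code-edges : Injection.to (code-List code-Edge) (map edge exits) ≡ edgesCode n
    code-edges =
      trans (code-List-map code-Edge (map edge exits))
      (trans (cong codeList codes) (foldr-++ consCode 0 (gateEdges (downFrom n)) _))
      where
      codes : map (Injection.to code-Edge) (map edge exits) ≡
              gateEdges (downFrom n) ++ map edgeCode₀ exits₀
      codes = trans (sym (map-∘ exits))
        (trans (map-cong (λ a → cong₂ pair (code-ι a) (code-ι (next a))) exits)
        (trans (map-++ edgeCode (cartesianProductWith gateExit (allFin↓ n) (true ∷ false ∷ []))
                       (map embed exits₀))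
        (cong₂ _++_ (trans (gateEdges-exits (allFin↓ n)) (cong gateEdges (map-toℕ-allFin↓ n)))
                    (trans (sym (map-∘ exits₀)) (map-cong edgeCode-embed exits₀)))))

    code-instance : Injection.to (code-Instance kit) (system , ι (embed target₀)) ≡ instanceCode n
    code-instance = cong₂ pair (cong₂ pair code-gadgets (cong (pair (suc N + n)) code-edges))
                      (trans (code-ι (embed target₀)) (locCode-embed target₀))

-- The reduction

compiled : PR 1 → Cmd
compiled c = ⟦ c ⟧ (0 ∷ []) 1

compiled-correct : ∀ c n → (∃[ y ] c [ n ∷ [] ]⇓ y) ⇔ (∃[ ρ ] compiled c ⊢ reg (n ∷ []) ⇒ ρ)
compiled-correct c n = mk⇔
  (λ { (y , y⇓) →
       let ρ , p , _ = run (Correct.sound (correct c) (n ∷ []) (0 ∷ []) args y⇓) (λ _ → refl)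
       in  ρ , p })
  (λ { (_ , p) → Correct.complete (correct c) (n ∷ []) (0 ∷ []) args (λ _ → refl) p })
  where
  open _∶_⟹_
  args : Args (n ∷ []) (0 ∷ []) (n ∷ [])
  args = slot [] ∷ []

module _ (prog : List Instr) where

  instanceOf : ℕ → Instance kit
  instanceOf n = Network.system prog n , Network.ι prog n (Wiring.embed prog n (Layout.target₀ prog))

  instanceOf-correct : ∀ n → (∃[ t ] Machine.Halts prog t 0 (reg (n ∷ []))) ⇔ RobotReachability kit (instanceOf n)
  instanceOf-correct n =
    ⇔-sym (Dynamics.reached⇔halts prog n (Network.system prog n) (Network.realisation prog n))

  instanceCode-computable : Computable (Codes.instanceCode prog)
  instanceCode-computable = computable {Codes.instanceCode prog} (Codes.total-instanceCode prog)

  instanceOf-computable : Computable (Injection.to (code-Instance kit) ∘ instanceOf)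
  instanceOf-computable = proj₁ instanceCode-computable , λ n →
    subst (λ m → proj₁ instanceCode-computable [ n ∷ [] ]⇓ m)
          (sym (Codes.code-instance prog n)) (proj₂ instanceCode-computable n)

-- The program for `L` is fixed and only the input varies, so computability is asked of each program
-- separately, not uniformly.
hard : ∀ {A} (code : A ↣ ℕ) (P : A → Set) (f : List Instr → ℕ → A) →
       (∀ prog → Computable (Injection.to code ∘ f prog)) →
       (∀ prog n → (∃[ t ] Machine.Halts prog t 0 (reg (n ∷ []))) ⇔ P (f prog n)) →
       REHard code P
hard code P f f-computable f-correct L (c , L⇔c) = f prog , f-computable prog , λ n →
  f-correct prog n ⇔-∘ (program-correct (compiled c) ⇔-∘ (compiled-correct c n ⇔-∘ L⇔c n))
  where
  prog : List Instr
  prog = program (compiled c)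

theorem3p2 : let Γ = increment ∷ register ∷ updsds ∷ []
    in REHard (code-Instance Γ) (RobotReachability Γ)
theorem3p2 = hard (code-Instance kit) (RobotReachability kit) instanceOf instanceOf-computable instanceOf-correct
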